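{- The functions $u_q$ ($q \in \mathbb{R}$) form a 1-parameter subgroup of $\widetilde{\mathcal{G}}$: $$ u_{q_1} * u_{q_2} = u_{q_1+q_2}, \qquad \text{for all } q_1,q_2 \in \mathbb{R}. $$
   Context: For $n \ge 1$, $NC(n)$ is the set of non-crossing partitions of $\{1,\ldots,n\}$, partially ordered by reverse refinement: $\pi \le \sigma$ iff every block of $\sigma$ is a union of blocks of $\pi$. $1_n \in NC(n)$ is the partition with a single block; $|\pi|$ is the number of blocks of $\pi$; $\pi \in NC(n)$ is called irreducible if $1$ and $n$ belong to the same block of $\pi$. Put $NC^{(2)} := \sqcup_{n=1}^{\infty} \{ (\pi,\sigma) \mid \pi,\sigma \in NC(n),\ \pi \le \sigma \}$. For $\pi \in NC(n)$ and a non-empty $W = \{p_1 < \cdots < p_m\} \subseteq \{1,\ldots,n\}$, $\pi_W \in NC(m)$ is the partition for which $i,j$ are in the same block of $\pi_W$ iff $p_i,p_j$ are in the same block of $\pi$. $\widetilde{\mathcal{G}}$ is the set of functions $g : NC^{(2)} \to \mathbb{C}$ such that $g(\pi,\pi)=1$ for all $\pi$ and $g(\pi,\sigma) = \prod_{W \in \sigma} g(\pi_W, 1_{|W|})$ for every $n \ge 1$ and $\pi \le \sigma$ in $NC(n)$. It is a group under convolution, $(f*g)(\pi,\sigma) = \sum_{\rho:\ \pi \le \rho \le \sigma} f(\pi,\rho) g(\rho,\sigma)$. A function $g \in \widetilde{\mathcal{G}}$ is uniquely determined by its values $g(\pi,1_n)$, and these values can be prescribed arbitrarily for $\pi \in NC(n)\setminus\{1_n\}$,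 $n \ge 1$. For $q \in \mathbb{R}$, $u_q$ is the unique function in $\widetilde{\mathcal{G}}$ such that for all $n \ge 1$ and $\pi \in NC(n)$: $u_q(\pi,1_n) = q^{|\pi|-1}$ if $\pi$ is irreducible, and $u_q(\pi,1_n)=0$ otherwise (with the convention $0^0=1$). -}

module Defs where

open import Algebra.Bundles using (CommutativeRing)
import Algebra.Properties.Ring as RingProperties
import Algebra.Solver.Ring.NaturalCoefficients.Default as SemiringSolver
open import Data.Bool.Base using (if_then_else_)
import Data.Bool.Properties as Bool
open import Data.Empty using (⊥-elim)
open import Data.Fin.Base using (Fin; zero; suc; fromℕ; cast; _<_)
import Data.Fin.Properties as Fin
open import Data.Fin.Subset using (Subset; inside; outside; ⊤; ⋃; _∈_; _⊆_; ∣_∣)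
open import Data.Fin.Subset.Properties
  using (_∈?_; _⊆?_; ∣⊤∣≡n; ∈⊤; ⊆⊤; ⊆-antisym; ∉⊥; x∈p∪q⁺; x∈p∪q⁻)
open import Data.List.Base
  using (List; []; _∷_; foldr; length; filter; deduplicate; mapMaybe; cartesianProductWith)
open import Data.List.Membership.Propositional using (mapWith∈) renaming (_∈_ to _∈ˡ_)
open import Data.List.Membership.Propositional.Properties
  using (∈-filter⁺; ∈-filter⁻; ∈-deduplicate⁺; ∈-deduplicate⁻)
open import Data.List.Properties using (filter-none)
open import Data.List.Relation.Unary.All as All using (All)
open import Data.List.Relation.Unary.Any using (here; there)
open import Data.Maybe.Base as Maybe using (Maybe)
open import Data.Nat.Base as ℕ using (ℕ; zero; suc; _∸_; NonZero)
import Data.Nat.Properties as ℕ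
open import Data.Product.Base using (∃; _×_; _,_; proj₁; proj₂)
open import Data.Rational.Base as ℚ using (ℚ; 0ℚ; 1ℚ; ½)
import Data.Rational.Properties as ℚ
open import Data.Sum.Base using (inj₁; inj₂)
open import Data.Vec.Base as Vec using (Vec; []; _∷_; lookup; tabulate; toList; replicate)
import Data.Vec.Membership.Propositional.Properties as Vec
open import Data.Vec.Properties
  using (≡-dec; []=⇒lookup; lookup⇒[]=; lookup∘tabulate; tabulate∘lookup; tabulate-cong;
         lookup-replicate)
open import Function.Base using (_∘_)
open import Level using (Level; _⊔_)
open import Relation.Binary.Definitions using (DecidableEquality)
open import Relation.Binary.PropositionalEquality
  using (_≡_; refl; sym; trans; cong; cong₂; subst)
open import Relation.Nullary.Decidable.Core
  using (Dec; yes; no; does; ¬?; map′; _×-dec_; _→-dec_; dec⇒maybe; recompute)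
open import Relation.Nullary.Negation.Core using (¬_)
open import Tactic.RingSolver.Core.AlmostCommutativeRing using (fromCommutativeRing)
import Tactic.RingSolver.NonReflective as RingSolver

private
  variable
    m n : ℕ
    c ℓ : Level

-- A partial equivalence relation: for Cauchy sequences it says that the
-- difference tends to zero, and `Close x x` says that x is Cauchy.
Close : (x y : ℕ → ℚ) → Set
Close x y = ∀ ε → 0ℚ ℚ.< ε → ∃ λ N → ∀ m n → N ℕ.≤ m → N ℕ.≤ n → ℚ.∣ x m ℚ.- y n ∣ ℚ.< ε

-- Cauchy sequences of rationals; equality of real numbers is _≃_.
record ℝ : Set where
  constructor mkℝ
  field
    seq    : ℕ → ℚ
    cauchy : Close seq seq

open ℝ

infix 4 _≃_
_≃_ : ℝ → ℝ → Set
x ≃ y = Close (seq x) (seq y)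

private
  module ℚ-Identities where
    module ℚ-Solver =
      RingSolver (fromCommutativeRing ℚ.+-*-commutativeRing (λ p → dec⇒maybe (0ℚ ℚ.≟ p)))
    open ℚ-Solver using (_⊕_; _⊗_; ⊝_; _⊜_)

    flip-sub : ∀ a b → ℚ.- (a ℚ.- b) ≡ b ℚ.- a
    flip-sub = ℚ-Solver.solve 2 (λ a b → (⊝ (a ⊕ ⊝ b)) ⊜ (b ⊕ ⊝ a)) refl

    telescope : ∀ a b c → (a ℚ.- b) ℚ.+ (b ℚ.- c) ≡ a ℚ.- c
    telescope = ℚ-Solver.solve 3 (λ a b c → ((a ⊕ ⊝ b) ⊕ (b ⊕ ⊝ c)) ⊜ (a ⊕ ⊝ c)) refl

    shuffle : ∀ a b c d → (a ℚ.- b) ℚ.+ (c ℚ.- d) ≡ (a ℚ.+ c) ℚ.- (b ℚ.+ d)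
    shuffle = ℚ-Solver.solve 4 (λ a b c d → ((a ⊕ ⊝ b) ⊕ (c ⊕ ⊝ d)) ⊜ ((a ⊕ c) ⊕ ⊝ (b ⊕ d))) refl

    neg-sub : ∀ a b → ℚ.- (a ℚ.- b) ≡ (ℚ.- a) ℚ.- (ℚ.- b)
    neg-sub = ℚ-Solver.solve 2 (λ a b → (⊝ (a ⊕ ⊝ b)) ⊜ ((⊝ a) ⊕ ⊝ (⊝ b))) refl

    cancel : ∀ a b → (a ℚ.- b) ℚ.+ b ≡ a
    cancel = ℚ-Solver.solve 2 (λ a b → ((a ⊕ ⊝ b) ⊕ b) ⊜ a) refl

    expand : ∀ a a′ b b′ → a ℚ.* (b ℚ.- b′) ℚ.+ b′ ℚ.* (a ℚ.- a′) ≡ a ℚ.* b ℚ.- a′ ℚ.* b′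
    expand = ℚ-Solver.solve 4 (λ a a′ b b′ → (a ⊗ (b ⊕ ⊝ b′) ⊕ b′ ⊗ (a ⊕ ⊝ a′)) ⊜ (a ⊗ b ⊕ ⊝ (a′ ⊗ b′))) refl

  open ℚ-Identities

  half : ∀ ε → 0ℚ ℚ.< ε → 0ℚ ℚ.< ½ ℚ.* ε
  half ε 0<ε = ℚ.*-monoʳ-<-pos ½ 0<ε

  halves : ∀ ε → ½ ℚ.* ε ℚ.+ ½ ℚ.* ε ≡ ε
  halves ε = trans (sym (ℚ.*-distribʳ-+ ε ½ ½)) (ℚ.*-identityˡ ε)

  -- |p| < ε/2, |q| < ε/2 ⇒ |p + q| < ε
  split : ∀ ε p q {r} → p ℚ.+ q ≡ r →
          ℚ.∣ p ∣ ℚ.< ½ ℚ.* ε → ℚ.∣ q ∣ ℚ.< ½ ℚ.* ε → ℚ.∣ r ∣ ℚ.< ε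
  split ε p q refl hp hq = ℚ.≤-<-trans (ℚ.∣p+q∣≤∣p∣+∣q∣ p q)
    (subst (ℚ.∣ p ∣ ℚ.+ ℚ.∣ q ∣ ℚ.<_) (halves ε) (ℚ.+-mono-< hp hq))

  close-sym : ∀ x y → Close x y → Close y x
  close-sym x y h ε 0<ε with N , p ← h ε 0<ε = N , λ m n N≤m N≤n →
    subst (ℚ._< ε) (trans (sym (ℚ.∣-p∣≡∣p∣ (x n ℚ.- y m))) (cong ℚ.∣_∣ (flip-sub (x n) (y m))))
      (p n m N≤n N≤m)

  close-trans : ∀ x y z → Close x y → Close y z → Close x z
  close-trans x y z h k ε 0<ε
    with N , p ← h _ (half ε 0<ε) | M , q ← k _ (half ε 0<ε) =
    N ℕ.⊔ M , λ m n l l′ →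
      split ε (x m ℚ.- y (N ℕ.⊔ M)) (y (N ℕ.⊔ M) ℚ.- z n) (telescope (x m) (y (N ℕ.⊔ M)) (z n))
        (p m (N ℕ.⊔ M) (ℕ.≤-trans (ℕ.m≤m⊔n N M) l) (ℕ.m≤m⊔n N M))
        (q (N ℕ.⊔ M) n (ℕ.m≤n⊔m N M) (ℕ.≤-trans (ℕ.m≤n⊔m N M) l′))

  close-+ : ∀ x x′ y y′ → Close x x′ → Close y y′ →
            Close (λ n → x n ℚ.+ y n) (λ n → x′ n ℚ.+ y′ n)
  close-+ x x′ y y′ h k ε 0<ε
    with N , p ← h _ (half ε 0<ε) | M , q ← k _ (half ε 0<ε) =
    N ℕ.⊔ M , λ m n l l′ →
      split ε (x m ℚ.- x′ n) (y m ℚ.- y′ n) (shuffle (x m) (x′ n) (y m) (y′ n))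
        (p m n (ℕ.≤-trans (ℕ.m≤m⊔n N M) l) (ℕ.≤-trans (ℕ.m≤m⊔n N M) l′))
        (q m n (ℕ.≤-trans (ℕ.m≤n⊔m N M) l) (ℕ.≤-trans (ℕ.m≤n⊔m N M) l′))

  close-neg : ∀ x y → Close x y → Close (λ n → ℚ.- x n) (λ n → ℚ.- y n)
  close-neg x y h ε 0<ε with N , p ← h ε 0<ε = N , λ m n l l′ →
    subst (ℚ._< ε) (trans (sym (ℚ.∣-p∣≡∣p∣ (x m ℚ.- y n))) (cong ℚ.∣_∣ (neg-sub (x m) (y n))))
      (p m n l l′)

  bound : ∀ x → Close x x →
          ∃ λ B → 0ℚ ℚ.< B × ∃ λ N → ∀ n → N ℕ.≤ n → ℚ.∣ x n ∣ ℚ.≤ B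
  bound x h with N , p ← h 1ℚ (ℚ.positive⁻¹ 1ℚ) =
    1ℚ ℚ.+ ℚ.∣ x N ∣ , ℚ.+-mono-<-≤ (ℚ.positive⁻¹ 1ℚ) (ℚ.0≤∣p∣ (x N)) , N , λ n l →
      ℚ.≤-trans (subst (ℚ._≤ ℚ.∣ x n ℚ.- x N ∣ ℚ.+ ℚ.∣ x N ∣) (cong ℚ.∣_∣ (cancel (x n) (x N)))
                  (ℚ.∣p+q∣≤∣p∣+∣q∣ (x n ℚ.- x N) (x N)))
                (ℚ.+-monoˡ-≤ ℚ.∣ x N ∣ (ℚ.<⇒≤ (p n N l ℕ.≤-refl)))

  -- |p| ≤ B, |q| < ε/B ⇒ |p q| < ε
  scale : ∀ ε → 0ℚ ℚ.< ε → ∀ B → 0ℚ ℚ.< B → ∃ λ δ → 0ℚ ℚ.< δ ×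
          (∀ p q → ℚ.∣ p ∣ ℚ.≤ B → ℚ.∣ q ∣ ℚ.< δ → ℚ.∣ p ℚ.* q ∣ ℚ.< ε)
  scale ε 0<ε B 0<B = ε ℚ.* B⁻¹ , subst (ℚ._< ε ℚ.* B⁻¹) (ℚ.*-zeroˡ B⁻¹) (ℚ.*-monoˡ-<-pos B⁻¹ 0<ε) ,
    λ p q hp hq → subst (ℚ._< ε) (sym (ℚ.∣p*q∣≡∣p∣*∣q∣ p q))
      (ℚ.≤-<-trans (ℚ.*-monoʳ-≤-nonNeg ℚ.∣ q ∣ {{ℚ.∣-∣-nonNeg q}} hp)
        (subst (B ℚ.* ℚ.∣ q ∣ ℚ.<_)
          (trans (cong (B ℚ.*_) (ℚ.*-comm ε B⁻¹))
            (trans (sym (ℚ.*-assoc B B⁻¹ ε))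
              (trans (cong (ℚ._* ε) (ℚ.*-inverseʳ B)) (ℚ.*-identityˡ ε))))
          (ℚ.*-monoʳ-<-pos B hq)))
    where
    instance
      B>0 : ℚ.Positive B
      B>0 = ℚ.positive 0<B
      B≢0 : ℚ.NonZero B
      B≢0 = ℚ.pos⇒nonZero B
    B⁻¹ : ℚ
    B⁻¹ = ℚ.1/ B
    instance
      B⁻¹>0 : ℚ.Positive B⁻¹
      B⁻¹>0 = ℚ.1/pos⇒pos B

  close-* : ∀ x x′ y y′ → Close x x → Close y′ y′ → Close x x′ → Close y y′ →
            Close (λ n → x n ℚ.* y n) (λ n → x′ n ℚ.* y′ n)
  close-* x x′ y y′ cx cy h k ε 0<ε =
    let B , 0<B , K , b = bound x cx
        C , 0<C , L , c = bound y′ cy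
        δ , 0<δ , s     = scale (½ ℚ.* ε) (half ε 0<ε) B 0<B
        η , 0<η , t     = scale (½ ℚ.* ε) (half ε 0<ε) C 0<C
        N , p           = k δ 0<δ
        M , q           = h η 0<η
        K⊔L≤ = ℕ.m≤m⊔n (K ℕ.⊔ L) (N ℕ.⊔ M)
        N⊔M≤ = ℕ.m≤n⊔m (K ℕ.⊔ L) (N ℕ.⊔ M)
        K≤ = ℕ.≤-trans (ℕ.m≤m⊔n K L) K⊔L≤
        L≤ = ℕ.≤-trans (ℕ.m≤n⊔m K L) K⊔L≤
        N≤ = ℕ.≤-trans (ℕ.m≤m⊔n N M) N⊔M≤
        M≤ = ℕ.≤-trans (ℕ.m≤n⊔m N M) N⊔M≤
    in (K ℕ.⊔ L) ℕ.⊔ (N ℕ.⊔ M) , λ m n l l′ →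
      split ε (x m ℚ.* (y m ℚ.- y′ n)) (y′ n ℚ.* (x m ℚ.- x′ n)) (expand (x m) (x′ n) (y m) (y′ n))
        (s (x m) (y m ℚ.- y′ n) (b m (ℕ.≤-trans K≤ l)) (p m n (ℕ.≤-trans N≤ l) (ℕ.≤-trans N≤ l′)))
        (t (y′ n) (x m ℚ.- x′ n) (c n (ℕ.≤-trans L≤ l′)) (q m n (ℕ.≤-trans M≤ l) (ℕ.≤-trans M≤ l′)))

  close-≗ : ∀ x y → Close x x → (∀ n → x n ≡ y n) → Close x y
  close-≗ x y cx e ε 0<ε with N , p ← cx ε 0<ε = N , λ m n l l′ →
    subst (λ t → ℚ.∣ x m ℚ.- t ∣ ℚ.< ε) (e n) (p m n l l′)

  close-const : ∀ a → Close (λ _ → a) (λ _ → a)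
  close-const a ε 0<ε = 0 , λ _ _ _ _ → subst (ℚ._< ε) (cong ℚ.∣_∣ (sym (ℚ.+-inverseʳ a))) 0<ε

fromℚ : ℚ → ℝ
fromℚ a = mkℝ (λ _ → a) (close-const a)

infixl 6 _+ᵣ_
infixl 7 _*ᵣ_
infix  8 -ᵣ_

_+ᵣ_ : ℝ → ℝ → ℝ
x +ᵣ y = mkℝ (λ n → seq x n ℚ.+ seq y n) (close-+ (seq x) (seq x) (seq y) (seq y) (cauchy x) (cauchy y))

_*ᵣ_ : ℝ → ℝ → ℝ
x *ᵣ y = mkℝ (λ n → seq x n ℚ.* seq y n)
             (close-* (seq x) (seq x) (seq y) (seq y) (cauchy x) (cauchy y) (cauchy x) (cauchy y))

-ᵣ_ : ℝ → ℝ
-ᵣ x = mkℝ (λ n → ℚ.- seq x n) (close-neg (seq x) (seq x) (cauchy x))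

private
  pointwise : ∀ x y → (∀ n → seq x n ≡ seq y n) → x ≃ y
  pointwise x y = close-≗ (seq x) (seq y) (cauchy x)

ℝ-commutativeRing : CommutativeRing _ _
ℝ-commutativeRing = record
  { Carrier = ℝ
  ; _≈_     = _≃_
  ; _+_     = _+ᵣ_
  ; _*_     = _*ᵣ_
  ; -_      = -ᵣ_
  ; 0#      = fromℚ 0ℚ
  ; 1#      = fromℚ 1ℚ
  ; isCommutativeRing = record
    { isRing = record
      { +-isAbelianGroup = record
        { isGroup = record
          { isMonoid = record
            { isSemigroup = record
              { isMagma = record
                { isEquivalence = record
                  { refl  = λ {x} → cauchy x
                  ; sym   = λ {x} {y} → close-sym (seq x) (seq y)
                  ; trans = λ {x} {y} {z} → close-trans (seq x) (seq y) (seq z)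
                  }
                ; ∙-cong = λ {x} {x′} {y} {y′} → close-+ (seq x) (seq x′) (seq y) (seq y′)
                }
              ; assoc = λ x y z → pointwise ((x +ᵣ y) +ᵣ z) (x +ᵣ (y +ᵣ z))
                          λ n → ℚ.+-assoc (seq x n) (seq y n) (seq z n)
              }
            ; identity = (λ x → pointwise (fromℚ 0ℚ +ᵣ x) x λ n → ℚ.+-identityˡ (seq x n))
                       , (λ x → pointwise (x +ᵣ fromℚ 0ℚ) x λ n → ℚ.+-identityʳ (seq x n))
            }
          ; inverse = (λ x → pointwise (-ᵣ x +ᵣ x) (fromℚ 0ℚ) λ n → ℚ.+-inverseˡ (seq x n))
                    , (λ x → pointwise (x +ᵣ -ᵣ x) (fromℚ 0ℚ) λ n → ℚ.+-inverseʳ (seq x n))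
          ; ⁻¹-cong = λ {x} {y} → close-neg (seq x) (seq y)
          }
        ; comm = λ x y → pointwise (x +ᵣ y) (y +ᵣ x) λ n → ℚ.+-comm (seq x n) (seq y n)
        }
      ; *-cong = λ {x} {x′} {y} {y′} →
          close-* (seq x) (seq x′) (seq y) (seq y′) (cauchy x) (cauchy y′)
      ; *-assoc = λ x y z → pointwise ((x *ᵣ y) *ᵣ z) (x *ᵣ (y *ᵣ z))
                    λ n → ℚ.*-assoc (seq x n) (seq y n) (seq z n)
      ; *-identity = (λ x → pointwise (fromℚ 1ℚ *ᵣ x) x λ n → ℚ.*-identityˡ (seq x n))
                   , (λ x → pointwise (x *ᵣ fromℚ 1ℚ) x λ n → ℚ.*-identityʳ (seq x n))
      ; distrib = (λ x y z → pointwise (x *ᵣ (y +ᵣ z)) (x *ᵣ y +ᵣ x *ᵣ z)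
                     λ n → ℚ.*-distribˡ-+ (seq x n) (seq y n) (seq z n))
                , (λ x y z → pointwise ((y +ᵣ z) *ᵣ x) (y *ᵣ x +ᵣ z *ᵣ x)
                     λ n → ℚ.*-distribʳ-+ (seq x n) (seq y n) (seq z n))
      }
    ; *-comm = λ x y → pointwise (x *ᵣ y) (y *ᵣ x) λ n → ℚ.*-comm (seq x n) (seq y n)
    }
  }

-- R[i]/(i² + 1)
module Complexification (R : CommutativeRing c ℓ) where
  open CommutativeRing R
    renaming (refl to ≈-refl; sym to ≈-sym; trans to ≈-trans)

  infix 6 _+i_
  record Complex : Set c where
    constructor _+i_
    field
      re im : Carrier

  open Complex public

  private
    open SemiringSolver commutativeSemiring using (solve; _:+_; _:*_; _:=_)
    open RingProperties ring using (-1*x≈-x)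

    infixl 6 _⊞_
    infixl 7 _⊡_

    _⊞_ _⊡_ : Complex → Complex → Complex
    (a +i b) ⊞ (c +i d) = (a + c) +i (b + d)
    (a +i b) ⊡ (c +i d) = (a * c + - (b * d)) +i (a * d + b * c)

    _≈ᶜ_ : Complex → Complex → Set ℓ
    z ≈ᶜ w = re z ≈ re w × im z ≈ im w

  commutativeRing : CommutativeRing c ℓ
  commutativeRing = record
    { Carrier = Complex
    ; _≈_     = _≈ᶜ_
    ; _+_     = _⊞_
    ; _*_     = _⊡_
    ; -_      = λ z → (- re z) +i (- im z)
    ; 0#      = 0# +i 0#
    ; 1#      = 1# +i 0#
    ; isCommutativeRing = record
      { isRing = record
        { +-isAbelianGroup = record
          { isGroup = record
            { isMonoid = record
              { isSemigroup = record
                { isMagma = record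
                  { isEquivalence = record
                    { refl  = ≈-refl , ≈-refl
                    ; sym   = λ (p , q) → ≈-sym p , ≈-sym q
                    ; trans = λ (p , q) (r , s) → ≈-trans p r , ≈-trans q s
                    }
                  ; ∙-cong = λ (p , q) (r , s) → +-cong p r , +-cong q s
                  }
                ; assoc = λ _ _ _ → +-assoc _ _ _ , +-assoc _ _ _
                }
              ; identity = (λ _ → +-identityˡ _ , +-identityˡ _)
                         , (λ _ → +-identityʳ _ , +-identityʳ _)
              }
            ; inverse = (λ _ → -‿inverseˡ _ , -‿inverseˡ _)
                      , (λ _ → -‿inverseʳ _ , -‿inverseʳ _)
            ; ⁻¹-cong = λ (p , q) → -‿cong p , -‿cong q
            }
          ; comm = λ _ _ → +-comm _ _ , +-comm _ _
          }
        ; *-cong = λ (p , q) (r , s) →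
            +-cong (*-cong p r) (-‿cong (*-cong q s)) , +-cong (*-cong p s) (*-cong q r)
        ; *-assoc = λ z w v →
            ≈ᶜ-trans (⊡≈⊡′ (z ⊡ w) v) (≈ᶜ-trans (⊡′-cong (⊡≈⊡′ z w) ≈ᶜ-refl)
              (≈ᶜ-trans (⊡′-assoc z w v)
                (≈ᶜ-sym (≈ᶜ-trans (⊡≈⊡′ z (w ⊡ v)) (⊡′-cong {z} ≈ᶜ-refl (⊡≈⊡′ w v))))))
        ; *-identity = *-identityˡᶜ , λ z → ≈ᶜ-trans (*-commᶜ z _) (*-identityˡᶜ z)
        ; distrib = distribˡᶜ , λ z w v →
            ≈ᶜ-trans (*-commᶜ (w ⊞ v) z) (≈ᶜ-trans (distribˡᶜ z w v)
              (+-congᶜ (*-commᶜ z w) (*-commᶜ z v)))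
        }
      ; *-comm = *-commᶜ
      }
    }
    where
    ≈ᶜ-refl : ∀ {z} → z ≈ᶜ z
    ≈ᶜ-refl = ≈-refl , ≈-refl
    ≈ᶜ-sym : ∀ {z w} → z ≈ᶜ w → w ≈ᶜ z
    ≈ᶜ-sym (p , q) = ≈-sym p , ≈-sym q
    ≈ᶜ-trans : ∀ {z w v} → z ≈ᶜ w → w ≈ᶜ v → z ≈ᶜ v
    ≈ᶜ-trans (p , q) (r , s) = ≈-trans p r , ≈-trans q s
    +-congᶜ : ∀ {z z′ w w′} → z ≈ᶜ z′ → w ≈ᶜ w′ → (z ⊞ w) ≈ᶜ (z′ ⊞ w′)
    +-congᶜ (p , q) (r , s) = +-cong p r , +-cong q s
    *-commᶜ : ∀ z w → (z ⊡ w) ≈ᶜ (w ⊡ z)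
    *-commᶜ z w = +-cong (*-comm _ _) (-‿cong (*-comm _ _)) ,
                  ≈-trans (+-comm _ _) (+-cong (*-comm _ _) (*-comm _ _))
    *-identityˡᶜ : ∀ z → ((1# +i 0#) ⊡ z) ≈ᶜ z
    *-identityˡᶜ (a +i b) =
      ≈-trans (+-cong (*-identityˡ a) (-‿cong (zeroˡ b)))
        (≈-trans (+-congˡ (≈-trans (≈-sym (+-identityˡ (- 0#))) (-‿inverseʳ 0#))) (+-identityʳ a)) ,
      ≈-trans (+-cong (*-identityˡ b) (zeroˡ a)) (+-identityʳ b)
    -- The multiplication with -1 in place of -, to which the semiring solver applies.
    ν : Carrier
    ν = - 1#
    _⊡′_ : Complex → Complex → Complex
    (a +i b) ⊡′ (c +i d) = (a * c + ν * (b * d)) +i (a * d + b * c)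
    ⊡≈⊡′ : ∀ z w → (z ⊡ w) ≈ᶜ (z ⊡′ w)
    ⊡≈⊡′ (a +i b) (c +i d) = +-congˡ (≈-sym (-1*x≈-x (b * d))) , ≈-refl
    ⊡′-cong : ∀ {z z′ w w′} → z ≈ᶜ z′ → w ≈ᶜ w′ → (z ⊡′ w) ≈ᶜ (z′ ⊡′ w′)
    ⊡′-cong (p , q) (r , s) =
      +-cong (*-cong p r) (*-congˡ (*-cong q s)) , +-cong (*-cong p s) (*-cong q r)
    ⊡′-assoc : ∀ z w v → ((z ⊡′ w) ⊡′ v) ≈ᶜ (z ⊡′ (w ⊡′ v))
    ⊡′-assoc (a +i b) (c +i d) (e +i f) =
      solve 7 (λ ν a b c d e f →
        ((a :* c :+ ν :* (b :* d)) :* e :+ ν :* ((a :* d :+ b :* c) :* f)) :=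
        (a :* (c :* e :+ ν :* (d :* f)) :+ ν :* (b :* (c :* f :+ d :* e))))
        ≈-refl ν a b c d e f ,
      solve 7 (λ ν a b c d e f →
        ((a :* c :+ ν :* (b :* d)) :* f :+ (a :* d :+ b :* c) :* e) :=
        (a :* (c :* f :+ d :* e) :+ b :* (c :* e :+ ν :* (d :* f))))
        ≈-refl ν a b c d e f
    distribˡ′ : ∀ z w v → (z ⊡′ (w ⊞ v)) ≈ᶜ ((z ⊡′ w) ⊞ (z ⊡′ v))
    distribˡ′ (a +i b) (c +i d) (e +i f) =
      solve 7 (λ ν a b c d e f →
        (a :* (c :+ e) :+ ν :* (b :* (d :+ f))) :=
        ((a :* c :+ ν :* (b :* d)) :+ (a :* e :+ ν :* (b :* f))))
        ≈-refl ν a b c d e f ,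
      solve 7 (λ ν a b c d e f →
        (a :* (d :+ f) :+ b :* (c :+ e)) :=
        ((a :* d :+ b :* c) :+ (a :* f :+ b :* e)))
        ≈-refl ν a b c d e f
    distribˡᶜ : ∀ z w v → (z ⊡ (w ⊞ v)) ≈ᶜ ((z ⊡ w) ⊞ (z ⊡ v))
    distribˡᶜ z w v = ≈ᶜ-trans (⊡≈⊡′ z (w ⊞ v)) (≈ᶜ-trans (distribˡ′ z w v)
      (≈ᶜ-sym (+-congᶜ (⊡≈⊡′ z w) (⊡≈⊡′ z v))))

-- The vector r lists, for each element i, the block containing i.
record IsPartition (r : Vec (Subset n) n) : Set where
  constructor isPartition
  field
    covers   : ∀ i → i ∈ lookup r i
    coherent : ∀ i j → j ∈ lookup r i → lookup r j ≡ lookup r i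

-- By coherence, the conclusion puts a, b, c and d into one block.
NonCrossing : Vec (Subset n) n → Set
NonCrossing r = ∀ a b c d → a < b → b < c → c < d →
                c ∈ lookup r a → d ∈ lookup r b → b ∈ lookup r a

-- Since the proofs are irrelevant, two elements of NC n with the same
-- underlying vector are propositionally equal.
record NC (n : ℕ) : Set where
  constructor mkNC
  field
    blockVec     : Vec (Subset n) n
    .partition   : IsPartition blockVec
    .nonCrossing : NonCrossing blockVec

  blockOf : Fin n → Subset n
  blockOf = lookup blockVec

open NC public using (blockVec; blockOf)

_≟ˢ_ : DecidableEquality (Subset n)
_≟ˢ_ = ≡-dec Bool._≟_

isPartition? : (r : Vec (Subset n) n) → Dec (IsPartition r)
isPartition? r = map′ (λ (p , q) → isPartition p q) (λ (isPartition p q) → p , q)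
  (Fin.all? (λ i → i ∈? lookup r i) ×-dec
   Fin.all? λ i → Fin.all? λ j → (j ∈? lookup r i) →-dec (lookup r j ≟ˢ lookup r i))

nonCrossing? : (r : Vec (Subset n) n) → Dec (NonCrossing r)
nonCrossing? r = Fin.all? λ a → Fin.all? λ b → Fin.all? λ c → Fin.all? λ d →
  (a Fin.<? b) →-dec (b Fin.<? c) →-dec (c Fin.<? d) →-dec
  (c ∈? lookup r a) →-dec (d ∈? lookup r b) →-dec (b ∈? lookup r a)

covers : (π : NC n) → ∀ i → i ∈ blockOf π i
covers (mkNC r p _) = IsPartition.covers (recompute (isPartition? r) p)

coherent : (π : NC n) → ∀ i j → j ∈ blockOf π i → blockOf π j ≡ blockOf π i
coherent (mkNC r p _) = IsPartition.coherent (recompute (isPartition? r) p)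

nonCrossing : (π : NC n) → NonCrossing (blockVec π)
nonCrossing (mkNC r _ p) = recompute (nonCrossing? r) p

blocks : NC n → List (Subset n)
blocks π = deduplicate _≟ˢ_ (toList (blockVec π))

#blocks : NC n → ℕ
#blocks π = length (blocks π)

infix 4 _≤_
_≤_ : NC n → NC n → Set
π ≤ σ = All (λ W → ∃ λ Vs → All (_∈ˡ blocks π) Vs × W ≡ ⋃ Vs) (blocks σ)

1ₙ : ∀ n → NC n
1ₙ n = mkNC (replicate n ⊤)
  (isPartition (λ i → subst (i ∈_) (sym (lookup-replicate i ⊤)) ∈⊤)
               (λ i j _ → trans (lookup-replicate j ⊤) (sym (lookup-replicate i ⊤))))
  (λ a b _ _ _ _ _ _ _ → subst (b ∈_) (sym (lookup-replicate a ⊤)) ∈⊤)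

first : ∀ n .{{_ : NonZero n}} → Fin n
first (suc n) = zero

last : ∀ n .{{_ : NonZero n}} → Fin n
last (suc n) = fromℕ n

Irreducible : .{{_ : NonZero n}} → NC n → Set
Irreducible {n} π = last n ∈ blockOf π (first n)

irreducible? : .{{_ : NonZero n}} (π : NC n) → Dec (Irreducible π)
irreducible? {n} π = last n ∈? blockOf π (first n)

allVecs : ∀ {a} {A : Set a} → List A → ∀ n → List (Vec A n)
allVecs xs zero    = [] ∷ []
allVecs xs (suc n) = cartesianProductWith _∷_ xs (allVecs xs n)

allSubsets : ∀ n → List (Subset n)
allSubsets = allVecs (inside ∷ outside ∷ [])

toNC : Vec (Subset n) n → Maybe (NC n)
toNC r = Maybe.map (λ (p , q) → mkNC r p q) (dec⇒maybe (isPartition? r ×-dec nonCrossing? r))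

-- Every non-crossing partition exactly once: vectors are the canonical form.
allNC : ∀ n → List (NC n)
allNC n = mapMaybe toNC (allVecs (allSubsets n) n)

blockOf∈blocks : (π : NC n) (i : Fin n) → blockOf π i ∈ˡ blocks π
blockOf∈blocks π i = ∈-deduplicate⁺ _≟ˢ_ (Vec.∈-toList⁺ (Vec.∈-lookup i (blockVec π)))

∈blocks⁻ : (π : NC n) {W : Subset n} → W ∈ˡ blocks π → ∃ λ i → W ≡ blockOf π i
∈blocks⁻ π W∈ = vec∈⁻ (blockVec π) (∈-deduplicate⁻ _≟ˢ_ (toList (blockVec π)) W∈)
  where
  vec∈⁻ : ∀ {a} {A : Set a} {x : A} (xs : Vec A m) → x ∈ˡ toList xs → ∃ λ i → x ≡ lookup xs i
  vec∈⁻ (_ ∷ _)  (here eq) = zero , eq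
  vec∈⁻ (_ ∷ xs) (there p) with i , eq ← vec∈⁻ xs p = suc i , eq

∈block⇒≡ : (π : NC n) {W : Subset n} → W ∈ˡ blocks π → ∀ {i} → i ∈ W → W ≡ blockOf π i
∈block⇒≡ π W∈ {i} i∈W with j , refl ← ∈blocks⁻ π W∈ = sym (coherent π j i i∈W)

∈⋃⁺ : {Vs : List (Subset n)} {V : Subset n} {i : Fin n} → V ∈ˡ Vs → i ∈ V → i ∈ ⋃ Vs
∈⋃⁺ (here refl) i∈V = x∈p∪q⁺ (inj₁ i∈V)
∈⋃⁺ (there p)   i∈V = x∈p∪q⁺ (inj₂ (∈⋃⁺ p i∈V))

∈⋃⁻ : (Vs : List (Subset n)) {i : Fin n} → i ∈ ⋃ Vs → ∃ λ V → V ∈ˡ Vs × i ∈ V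
∈⋃⁻ []       i∈ = ⊥-elim (∉⊥ i∈)
∈⋃⁻ (V ∷ Vs) i∈ with x∈p∪q⁻ V (⋃ Vs) i∈
... | inj₁ i∈V = V , here refl , i∈V
... | inj₂ i∈⋃ with U , U∈ , i∈U ← ∈⋃⁻ Vs i∈⋃ = U , there U∈ , i∈U

≤⇒⊆ : (π σ : NC n) → π ≤ σ → ∀ i → blockOf π i ⊆ blockOf σ i
≤⇒⊆ π σ π≤σ i j∈
  with Vs , Vs⊆ , eq ← All.lookup π≤σ (blockOf∈blocks σ i)
  with V , V∈Vs , i∈V ← ∈⋃⁻ Vs (subst (i ∈_) eq (covers σ i))
  = subst (_ ∈_) (sym eq) (∈⋃⁺ V∈Vs
      (subst (_ ∈_) (sym (∈block⇒≡ π (All.lookup Vs⊆ V∈Vs) i∈V)) j∈))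

⊆⇒≤ : (π σ : NC n) → (∀ i → blockOf π i ⊆ blockOf σ i) → π ≤ σ
⊆⇒≤ π σ sub = All.tabulate λ {W} W∈ →
  filter (_⊆? W) (blocks π) ,
  All.tabulate (λ V∈ → proj₁ (∈-filter⁻ (_⊆? W) {xs = blocks π} V∈)) ,
  ⊆-antisym
    (λ {i} i∈W → ∈⋃⁺ (∈-filter⁺ (_⊆? W) (blockOf∈blocks π i)
        (λ j∈ → subst (_ ∈_) (sym (∈block⇒≡ σ W∈ i∈W)) (sub i j∈)))
      (covers π i))
    (λ i∈⋃ → let V , V∈ , i∈V = ∈⋃⁻ (filter (_⊆? W) (blocks π)) i∈⋃
              in proj₂ (∈-filter⁻ (_⊆? W) {xs = blocks π} V∈) i∈V)

infix 4 _≤?_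
_≤?_ : (π σ : NC n) → Dec (π ≤ σ)
π ≤? σ = map′ (⊆⇒≤ π σ) (≤⇒⊆ π σ) (Fin.all? λ i → blockOf π i ⊆? blockOf σ i)

≤-refl : (π : NC n) → π ≤ π
≤-refl π = ⊆⇒≤ π π λ i j∈ → j∈

≤1ₙ : (π : NC n) → π ≤ 1ₙ n
≤1ₙ {n} π = ⊆⇒≤ π (1ₙ n) λ i → subst (blockOf π i ⊆_) (sym (lookup-replicate i ⊤)) ⊆⊤

block-nonZero : (π : NC n) {W : Subset n} → W ∈ˡ blocks π → NonZero ∣ W ∣
block-nonZero π W∈ with i , refl ← ∈blocks⁻ π W∈ = nonEmpty (covers π i)
  where
  nonEmpty : ∀ {n} {W : Subset n} {i} → i ∈ W → NonZero ∣ W ∣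
  nonEmpty {W = inside  ∷ W} _                    = _
  nonEmpty {W = outside ∷ W} (Vec.there i∈W) = nonEmpty i∈W

-- The increasing enumeration p₁ < ... < pₘ of the elements of W.
elements : (W : Subset n) → Fin ∣ W ∣ → Fin n
elements (inside  ∷ W) zero    = zero
elements (inside  ∷ W) (suc i) = suc (elements W i)
elements (outside ∷ W) i       = suc (elements W i)

elements-mono : (W : Subset n) {i j : Fin ∣ W ∣} → i < j → elements W i < elements W j
elements-mono (inside  ∷ W) {zero}  {suc j} _   = ℕ.s≤s ℕ.z≤n
elements-mono (inside  ∷ W) {suc i} {suc j} (ℕ.s≤s lt) = ℕ.s≤s (elements-mono W lt)
elements-mono (outside ∷ W) lt = ℕ.s≤s (elements-mono W lt)

elements∈ : (W : Subset n) (i : Fin ∣ W ∣) → elements W i ∈ W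
elements∈ (inside  ∷ W) zero    = Vec.here
elements∈ (inside  ∷ W) (suc i) = Vec.there (elements∈ W i)
elements∈ (outside ∷ W) i       = Vec.there (elements∈ W i)

pullback : (Fin m → Fin n) → Subset n → Subset m
pullback p V = tabulate (lookup V ∘ p)

∈pullback⁺ : (p : Fin m → Fin n) (V : Subset n) {i : Fin m} → p i ∈ V → i ∈ pullback p V
∈pullback⁺ p V {i} pi∈ = lookup⇒[]= i _ (trans (lookup∘tabulate _ i) ([]=⇒lookup pi∈))

∈pullback⁻ : (p : Fin m → Fin n) (V : Subset n) {i : Fin m} → i ∈ pullback p V → p i ∈ V
∈pullback⁻ p V {i} i∈ = lookup⇒[]= (p i) V (trans (sym (lookup∘tabulate _ i)) ([]=⇒lookup i∈))

infixl 8 _↾_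
_↾_ : NC n → (W : Subset n) → NC ∣ W ∣
_↾_ {n} π W = mkNC r
  (isPartition
    (λ i → ∈r⁺ i i (covers π (p i)))
    (λ i j j∈ → trans (r-at j) (trans (cong (pullback p) (coherent π (p i) (p j) (∈r⁻ i j j∈))) (sym (r-at i)))))
  (λ a b c d a<b b<c c<d c∈ d∈ → ∈r⁺ a b
    (nonCrossing π (p a) (p b) (p c) (p d)
      (elements-mono W a<b) (elements-mono W b<c) (elements-mono W c<d) (∈r⁻ a c c∈) (∈r⁻ b d d∈)))
  where
  p : Fin ∣ W ∣ → Fin n
  p = elements W
  r : Vec (Subset ∣ W ∣) ∣ W ∣
  r = tabulate λ i → pullback p (blockOf π (p i))
  r-at : ∀ i → lookup r i ≡ pullback p (blockOf π (p i))
  r-at = lookup∘tabulate _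
  ∈r⁺ : ∀ i j → p j ∈ blockOf π (p i) → j ∈ lookup r i
  ∈r⁺ i j h = subst (j ∈_) (sym (r-at i)) (∈pullback⁺ p _ h)
  ∈r⁻ : ∀ i j → j ∈ lookup r i → p j ∈ blockOf π (p i)
  ∈r⁻ i j h = ∈pullback⁻ p _ (subst (j ∈_) (r-at i) h)

NC-≡ : {π σ : NC n} → (∀ i → blockOf π i ≡ blockOf σ i) → π ≡ σ
NC-≡ {π = mkNC r _ _} {mkNC s _ _} e
  with refl ← trans (sym (tabulate∘lookup r)) (trans (tabulate-cong e) (tabulate∘lookup s)) = refl

blockOf-↾ : (π : NC n) (W : Subset n) (i : Fin ∣ W ∣) →
            blockOf (π ↾ W) i ≡ pullback (elements W) (blockOf π (elements W i))
blockOf-↾ π W = lookup∘tabulate _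

↾-block : (π : NC n) {W : Subset n} → W ∈ˡ blocks π → π ↾ W ≡ 1ₙ ∣ W ∣
↾-block π {W} W∈ = NC-≡ λ i → trans (blockOf-↾ π W i)
  (trans (⊆-antisym ⊆⊤ (λ {j} _ → ∈pullback⁺ (elements W) _
            (subst (elements W j ∈_) (∈block⇒≡ π W∈ (elements∈ W i)) (elements∈ W j))))
         (sym (lookup-replicate i ⊤)))

blocks-1ₙ : ∀ n .{{_ : NonZero n}} → blocks (1ₙ n) ≡ ⊤ ∷ []
blocks-1ₙ (suc n) = cong (⊤ ∷_) (filter-none (¬? ∘ (⊤ ≟ˢ_)) {xs = deduplicate _≟ˢ_ (toList (replicate n ⊤))}
    (All.tabulate λ W∈ ⊤≢W → ⊤≢W (allTop n (∈-deduplicate⁻ _≟ˢ_ (toList (replicate n ⊤)) W∈))))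
  where
  allTop : ∀ k {W : Subset m} → W ∈ˡ toList (replicate k ⊤) → ⊤ ≡ W
  allTop (suc k) (here refl) = refl
  allTop (suc k) (there p)   = allTop k p

restrict-⊤ : ∀ {a} {A : Set a} (h : ∀ {n} → .{{NonZero n}} → NC n → A)
             {n : ℕ} .{{_ : NonZero n}} .{{_ : NonZero ∣ ⊤ {n} ∣}} (π : NC n) → h (π ↾ ⊤) ≡ h π
restrict-⊤ h {n} π = transport (∣⊤∣≡n n) (π ↾ ⊤) λ i j →
  trans (cong (λ V → lookup V j) (blockOf-↾ π ⊤ i))
    (trans (lookup∘tabulate _ j)
      (cong₂ (λ a b → lookup (blockOf π a) b) (elements-⊤ n i) (elements-⊤ n j)))
  where
  elements-⊤ : ∀ n (i : Fin ∣ ⊤ {n} ∣) → elements ⊤ i ≡ cast (∣⊤∣≡n n) i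
  elements-⊤ (suc n) zero    = refl
  elements-⊤ (suc n) (suc i) = cong suc (elements-⊤ n i)

  transport : ∀ {k} (eq : k ≡ n) .{{_ : NonZero k}} (ρ : NC k) →
              (∀ i j → lookup (blockOf ρ i) j ≡
                       lookup (blockOf π (cast eq i)) (cast eq j)) →
              h ρ ≡ h π
  transport refl ρ e = cong h (NC-≡ λ i →
    trans (sym (tabulate∘lookup (blockOf ρ i)))
      (trans (tabulate-cong λ j → trans (e i j)
               (cong₂ (λ a b → lookup (blockOf π a) b) (Fin.cast-is-id refl i) (Fin.cast-is-id refl j)))
             (tabulate∘lookup (blockOf π i))))

record NC⁽²⁾ : Set where
  constructor pair
  field
    {size}      : ℕ
    .{{nonZero}} : NonZero size
    lower upper : NC size
    .lower≤upper : lower ≤ upper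

interval : (π σ : NC n) → List (NC n)
interval {n} π σ = filter (λ ρ → (π ≤? ρ) ×-dec (ρ ≤? σ)) (allNC n)

∈interval⁻ : (π σ : NC n) {ρ : NC n} → ρ ∈ˡ interval π σ → π ≤ ρ × ρ ≤ σ
∈interval⁻ {n} π σ ρ∈ = proj₂ (∈-filter⁻ (λ ρ → (π ≤? ρ) ×-dec (ρ ≤? σ)) {xs = allNC n} ρ∈)

-- Values in an arbitrary commutative ring; instantiated to ℂ at the end.
module Functions (K : CommutativeRing c ℓ) where
  open CommutativeRing K
    renaming (refl to ≈-refl; sym to ≈-sym; trans to ≈-trans; reflexive to ≈-reflexive)
  open import Algebra.Properties.Semiring.Exp semiring using (_^_)

  ∑ ∏ : List Carrier → Carrier
  ∑ = foldr _+_ 0#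
  ∏ = foldr _*_ 1#

  infix 4 _≋_
  _≋_ : (f g : NC⁽²⁾ → Carrier) → Set ℓ
  f ≋ g = ∀ x → f x ≈ g x

  -- The order proofs passed to f and g are irrelevant arguments of pair.
  infixl 7 _∗_
  _∗_ : (f g : NC⁽²⁾ → Carrier) → NC⁽²⁾ → Carrier
  (f ∗ g) (pair π σ _) = ∑ (mapWith∈ (interval π σ) λ {ρ} ρ∈ →
    f (pair π ρ (proj₁ (∈interval⁻ π σ ρ∈))) * g (pair ρ σ (proj₂ (∈interval⁻ π σ ρ∈))))

  record G̃ : Set (c ⊔ ℓ) where
    field
      fun            : NC⁽²⁾ → Carrier
      normalised     : ∀ {n} .{{_ : NonZero n}} (π : NC n) → fun (pair π π (≤-refl π)) ≈ 1#
      multiplicative : ∀ {n} .{{_ : NonZero n}} (π σ : NC n) (π≤σ : π ≤ σ) →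
        fun (pair π σ π≤σ) ≈
        ∏ (mapWith∈ (blocks σ) λ {W} W∈ →
             fun (pair {{block-nonZero σ W∈}} (π ↾ W) (1ₙ ∣ W ∣) (≤1ₙ (π ↾ W))))

  open G̃ public

  private
    ∏-cong : ∀ {a} {A : Set a} (xs : List A) {f g : ∀ {x} → x ∈ˡ xs → Carrier} →
             (∀ {x} (x∈ : x ∈ˡ xs) → f x∈ ≈ g x∈) → ∏ (mapWith∈ xs f) ≈ ∏ (mapWith∈ xs g)
    ∏-cong []       e = ≈-refl
    ∏-cong (x ∷ xs) e = *-cong (e (here refl)) (∏-cong xs (e ∘ there))

    ∏-1 : ∀ {a} {A : Set a} (xs : List A) {f : ∀ {x} → x ∈ˡ xs → Carrier} →
          (∀ {x} (x∈ : x ∈ˡ xs) → f x∈ ≈ 1#) → ∏ (mapWith∈ xs f) ≈ 1#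
    ∏-1 []       e = ≈-refl
    ∏-1 (x ∷ xs) e = ≈-trans (*-cong (e (here refl)) (∏-1 xs (e ∘ there))) (*-identityˡ 1#)

  -- An element of G̃ is determined by its values at the pairs (π , 1ₙ) ...
  G̃-unique : (f g : G̃) →
    (∀ {n} .{{_ : NonZero n}} (π : NC n) →
       fun f (pair π (1ₙ n) (≤1ₙ π)) ≈ fun g (pair π (1ₙ n) (≤1ₙ π))) →
    fun f ≋ fun g
  G̃-unique f g e (pair {n} π σ π≤σ) =
    ≈-trans (multiplicative f π σ (recompute (π ≤? σ) π≤σ))
      (≈-trans (∏-cong (blocks σ) λ {W} W∈ → e {{block-nonZero σ W∈}} (π ↾ W))
               (≈-sym (multiplicative g π σ (recompute (π ≤? σ) π≤σ))))

  -- ... which can be prescribed arbitrarily for π ≠ 1ₙ.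
  module Prescribed (h : ∀ {n} → .{{NonZero n}} → NC n → Carrier)
                    (h-1ₙ : ∀ n → .{{_ : NonZero n}} → h (1ₙ n) ≈ 1#) where

    private
      ext : NC⁽²⁾ → Carrier
      ext (pair π σ _) = ∏ (mapWith∈ (blocks σ) λ {W} W∈ → h {{block-nonZero σ W∈}} (π ↾ W))

      ∏-single : ∀ {n} .{{nz₀ : NonZero n}} (π : NC n) (Ws : List (Subset n)) → Ws ≡ ⊤ ∷ [] →
                 (nz : ∀ {W} → W ∈ˡ Ws → NonZero ∣ W ∣) →
                 ∏ (mapWith∈ Ws λ {W} W∈ → h {{nz W∈}} (π ↾ W)) ≈ h π
      ∏-single {{nz₀}} π _ refl nz = ≈-trans (*-identityʳ _)
        (≈-reflexive (restrict-⊤ h {{nz₀}} {{nz (here refl)}} π))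

    ext-1ₙ : ∀ {n} .{{_ : NonZero n}} (π : NC n) → ext (pair π (1ₙ n) (≤1ₙ π)) ≈ h π
    ext-1ₙ {n} π = ∏-single π (blocks (1ₙ n)) (blocks-1ₙ n) (block-nonZero (1ₙ n))

    extension : G̃
    extension = record
      { fun            = ext
      ; normalised     = λ π → ∏-1 (blocks π) λ {W} W∈ → let instance _ = block-nonZero π W∈ in
          ≈-trans (≈-reflexive (cong (λ ρ → h ρ) (↾-block π W∈))) (h-1ₙ ∣ W ∣)
      ; multiplicative = λ π σ π≤σ → ∏-cong (blocks σ) λ {W} W∈ →
          ≈-sym (ext-1ₙ {{block-nonZero σ W∈}} (π ↾ W))
      }

  uValue : Carrier → .{{NonZero n}} → NC n → Carrier
  uValue q π = if does (irreducible? π) then q ^ (#blocks π ∸ 1) else 0#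

  uValue-1ₙ : ∀ q n .{{_ : NonZero n}} → uValue q (1ₙ n) ≈ 1#
  uValue-1ₙ q n with irreducible? (1ₙ n)
  ... | yes _ = ≈-reflexive (cong (λ Ws → q ^ (length Ws ∸ 1)) (blocks-1ₙ n))
  ... | no ¬p = ⊥-elim (¬p (subst (last n ∈_) (sym (lookup-replicate (first n) ⊤)) ∈⊤))

  -- The element of G̃ with the values in u-irreducible and u-reducible below,
  -- hence the only one by G̃-unique.  Here 0# ^ 0 = 1#.
  u : Carrier → G̃
  u q = Prescribed.extension (uValue q) (uValue-1ₙ q)

  u-irreducible : ∀ q {n} .{{_ : NonZero n}} (π : NC n) → Irreducible π →
                  fun (u q) (pair π (1ₙ n) (≤1ₙ π)) ≈ q ^ (#blocks π ∸ 1)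
  u-irreducible q π irr with eq ← Prescribed.ext-1ₙ (uValue q) (uValue-1ₙ q) π with irreducible? π
  ... | yes _   = eq
  ... | no ¬irr = ⊥-elim (¬irr irr)

  u-reducible : ∀ q {n} .{{_ : NonZero n}} (π : NC n) → ¬ Irreducible π →
                fun (u q) (pair π (1ₙ n) (≤1ₙ π)) ≈ 0#
  u-reducible q π ¬irr with eq ← Prescribed.ext-1ₙ (uValue q) (uValue-1ₙ q) π with irreducible? π
  ... | yes irr = ⊥-elim (¬irr irr)
  ... | no _    = eq

open Complexification ℝ-commutativeRing public
  renaming (Complex to ℂ; commutativeRing to ℂ-commutativeRing)

open Functions ℂ-commutativeRing public renaming (u to uᶜ)

u : ℝ → G̃
u q = uᶜ (q +i fromℚ 0ℚ)

{-# OPTIONS --safe #-}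
module Submission where

-- Every u_q (π , σ) equals q ^ d when π ≪ σ, and 0 otherwise, where π ≪ σ means
-- that π ≤ σ and that the minimum and the maximum of each block of σ lie in one
-- block of π, and d is the number of elements that are minima of blocks of π but
-- not of blocks of σ.  For the convolution, choose the least such element v.  The
-- partitions ρ with π ≪ ρ ≪ σ that have v as a minimum are those below some
-- σ′ ≪ σ, the others those above some π′ ≫ π, and d (π , σ′) = d (π′ , σ) = d − 1.
-- Hence the sum S over the interval satisfies
-- S (π , σ) = q₁ S (π′ , σ) + q₂ S (π , σ′), as (q₁ + q₂) ^ d does.

open import Defs hiding (∑; ∏; _∗_; _≋_; fun; uValue; u)

import Data.Nat.Properties as ℕ
open import Algebra.Bundles using (CommutativeMonoid; CommutativeRing)
open import Algebra.Properties.CommutativeMonoid.Sum ℕ.+-0-commutativeMonoid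
  using (sum-cong-≗; sum-replicate-zero; ∑-distrib-+) renaming (sum to ∑ᶠ)
import Algebra.Properties.Semiring.Exp as Exp
open import Data.Bool.Base using (true; false; if_then_else_)
open import Data.Empty using (⊥-elim)
open import Data.Fin.Base as Fin using (Fin; zero; suc)
import Data.Fin.Properties as Fin
open import Data.Fin.Subset using (Subset; inside; outside; _∈_; ∣_∣)
open import Data.Fin.Subset.Properties using (_∈?_; ⊆-antisym)
open import Data.List.Base using (List; []; _∷_; foldr; map; filter; length; mapMaybe)
open import Data.List.Membership.Propositional using (mapWith∈) renaming (_∈_ to _∈ˡ_)
open import Data.List.Membership.Propositional.Properties
  using (∈-cartesianProductWith⁺; ∈-filter⁺; ∈-map⁻)
open import Data.List.Relation.Unary.All as All using ([]; _∷_)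
open import Data.List.Relation.Unary.AllPairs using ([]; _∷_)
open import Data.List.Relation.Unary.Any using (here; there)
open import Data.List.Relation.Unary.Unique.Propositional using (Unique)
import Data.List.Relation.Unary.Unique.DecPropositional.Properties as Unique
import Data.List.Relation.Unary.Unique.Propositional.Properties as Unique
import Data.Maybe.Base as Maybe
open import Data.Nat.Base as ℕ using (ℕ; zero; suc; NonZero; _∸_)
open import Data.Product.Base using (∃; _×_; _,_; proj₁; proj₂)
open import Data.Rational.Base using (0ℚ)
open import Data.Sum.Base using (_⊎_; inj₁; inj₂; [_,_]′)
open import Data.Vec.Base using (Vec; []; _∷_; lookup; tabulate; there)
open import Data.Vec.Properties
  using ([]=⇒lookup; lookup⇒[]=; lookup∘tabulate; tabulate-cong; ∷-injective)
open import Function.Base using (_∘_; id; case_of_)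
open import Function.Bundles using (mk⇔)
open import Level using (Level)
open import Relation.Binary.Core using (Rel)
import Relation.Binary.Definitions as Binary
open import Relation.Binary.Definitions using (tri<; tri≈; tri>)
open import Relation.Binary.PropositionalEquality
  using (_≡_; _≢_; refl; sym; trans; cong; cong₂; subst)
import Relation.Binary.Reasoning.Setoid as SetoidReasoning
open import Relation.Binary.Structures using (IsEquivalence)
open import Relation.Nullary.Decidable
  using (Dec; yes; no; does; ¬?; map′; _×-dec_; _⊎-dec_; _→-dec_; dec-true; dec-false;
         does-⇔; recompute; decidable-stable; dec⇒maybe)
open import Relation.Nullary.Negation using (¬_; contradiction)
open import Relation.Unary using (Pred; Decidable)

private
  variable
    a ℓ : Level
    A : Set a
    m n : ℕ

-- Extremal elements of decidable subsets

least : {P : Pred (Fin n) ℓ} → Decidable P → ∃ P →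
        ∃ λ i → P i × (∀ j → P j → i Fin.≤ j)
least {n = suc n} P? (i , Pi) with P? zero
least {n = suc n} P? (i     , Pi) | yes P0 = zero , P0 , λ _ _ → ℕ.z≤n
least {n = suc n} P? (zero  , P0) | no ¬P0 = contradiction P0 ¬P0
least {n = suc n} P? (suc i , Pi) | no ¬P0
  with k , Pk , min ← least (P? ∘ suc) (i , Pi) =
  suc k , Pk , λ { zero P0 → contradiction P0 ¬P0 ; (suc j) Pj → ℕ.s≤s (min j Pj) }

greatest : {P : Pred (Fin n) ℓ} → Decidable P → ∃ P →
           ∃ λ i → P i × (∀ j → P j → j Fin.≤ i)
greatest {n = suc n} P? (i , Pi) with Fin.any? (P? ∘ suc)
... | yes w with k , Pk , max ← greatest (P? ∘ suc) w =
  suc k , Pk , λ { zero _ → ℕ.z≤n ; (suc j) Pj → ℕ.s≤s (max j Pj) }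
greatest {n = suc n} P? (zero  , P0) | no none =
  zero , P0 , λ { zero _ → ℕ.z≤n ; (suc j) Pj → contradiction (j , Pj) none }
greatest {n = suc n} P? (suc i , Pi) | no none = contradiction (i , Pi) none

-- Non-crossing partitions as equivalence relations

infix 4 _∼[_]_
-- A record and not a synonym, so that unification recovers `i`, `π` and `j` from the type, which it
-- could not do once `blockOf` is unfolded.
record _∼[_]_ (i : Fin n) (π : NC n) (j : Fin n) : Set where
  constructor in-block
  field ∈block : j ∈ blockOf π i

open _∼[_]_

module _ (π : NC n) where

  ∼-refl : ∀ {i} → i ∼[ π ] i
  ∼-refl {i} = in-block (covers π i)

  ∼-sym : ∀ {i j} → i ∼[ π ] j → j ∼[ π ] i
  ∼-sym {i} {j} (in-block j∈) = in-block (subst (i ∈_) (sym (coherent π i j j∈)) (covers π i))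

  ∼-trans : ∀ {i j k} → i ∼[ π ] j → j ∼[ π ] k → i ∼[ π ] k
  ∼-trans {i} {j} {k} (in-block j∈) (in-block k∈) = in-block (subst (k ∈_) (coherent π i j j∈) k∈)

  ∼-noncrossing : ∀ {a b c d} → a Fin.< b → b Fin.< c → c Fin.< d →
                  a ∼[ π ] c → b ∼[ π ] d → a ∼[ π ] b
  ∼-noncrossing a<b b<c c<d (in-block c∈) (in-block d∈) =
    in-block (nonCrossing π _ _ _ _ a<b b<c c<d c∈ d∈)

  _∼?_ : ∀ i j → Dec (i ∼[ π ] j)
  i ∼? j = map′ in-block ∈block (j ∈? blockOf π i)

∼-ext : {π σ : NC n} → (∀ {i j} → i ∼[ π ] j → i ∼[ σ ] j) → (∀ {i j} → i ∼[ σ ] j → i ∼[ π ] j) → π ≡ σ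
∼-ext f g = NC-≡ λ i → ⊆-antisym (∈block ∘ f ∘ in-block) (∈block ∘ g ∘ in-block)

module FromEquivalence
  {R : Rel (Fin n) ℓ} (R? : Binary.Decidable R) (R-equivalence : IsEquivalence R)
  (R-noncrossing : ∀ {a b c d} → a Fin.< b → b Fin.< c → c Fin.< d → R a c → R b d → R a b) where

  private
    module R = IsEquivalence R-equivalence

    vec : Vec (Subset n) n
    vec = tabulate λ i → tabulate λ j → does (R? i j)

    lookup-vec : ∀ i j → lookup (lookup vec i) j ≡ does (R? i j)
    lookup-vec i j = trans (cong (λ V → lookup V j) (lookup∘tabulate _ i)) (lookup∘tabulate _ j)

    ∈⁺ : ∀ {i j} → R i j → j ∈ lookup vec i
    ∈⁺ {i} {j} r = lookup⇒[]= j _ (trans (lookup-vec i j) (dec-true (R? i j) r))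

    ∈⁻ : ∀ {i j} → j ∈ lookup vec i → R i j
    ∈⁻ {i} {j} j∈ with R? i j | trans (sym (lookup-vec i j)) ([]=⇒lookup j∈)
    ... | yes r | _ = r

  -- Later proofs see `partition` through `∼⁺` and `∼⁻` only, never its vector of bits.
  abstract
    partition : NC n
    partition = mkNC vec
      (isPartition (λ i → ∈⁺ R.refl) λ i j j∈ →
        trans (lookup∘tabulate _ j)
          (trans (tabulate-cong λ k → does-⇔
                   (mk⇔ (R.trans (∈⁻ j∈)) (R.trans (R.sym (∈⁻ j∈)))) (R? j k) (R? i k))
                 (sym (lookup∘tabulate _ i))))
      (λ a b c d a<b b<c c<d c∈ d∈ → ∈⁺ (R-noncrossing a<b b<c c<d (∈⁻ c∈) (∈⁻ d∈)))

    ∼⁺ : ∀ {i j} → R i j → i ∼[ partition ] j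
    ∼⁺ r = in-block (∈⁺ r)

    ∼⁻ : ∀ {i j} → i ∼[ partition ] j → R i j
    ∼⁻ (in-block j∈) = ∈⁻ j∈

-- Minima and maxima of blocks, and the order that they define

IsMin IsMax : NC n → Pred (Fin n) _
IsMin π i = ∀ j → i ∼[ π ] j → i Fin.≤ j
IsMax π i = ∀ j → i ∼[ π ] j → j Fin.≤ i

abstract
  isMin? : (π : NC n) → Decidable (IsMin π)
  isMin? π i = Fin.all? λ j → (_∼?_ π i j) →-dec (i Fin.≤? j)

  isMax? : (π : NC n) → Decidable (IsMax π)
  isMax? π i = Fin.all? λ j → (_∼?_ π i j) →-dec (j Fin.≤? i)

abstract
  min-of : (π : NC n) (i : Fin n) → ∃ λ k → i ∼[ π ] k × IsMin π k
  min-of π i with k , i∼k , min ← least (_∼?_ π i) (i , ∼-refl π) =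
    k , i∼k , λ j k∼j → min j (∼-trans π i∼k k∼j)

  max-of : (π : NC n) (i : Fin n) → ∃ λ k → i ∼[ π ] k × IsMax π k
  max-of π i with k , i∼k , max ← greatest (_∼?_ π i) (i , ∼-refl π) =
    k , i∼k , λ j k∼j → max j (∼-trans π i∼k k∼j)

-- The order of Belinschi and Nica.
infix 4 _≪_ _≪?_
record _≪_ (π σ : NC n) : Set where
  constructor mk≪
  field
    finer : ∀ {i j} → i ∼[ π ] j → i ∼[ σ ] j
    ends  : ∀ {a b} → IsMin σ a → IsMax σ b → a ∼[ σ ] b → a ∼[ π ] b

  min-antitone : ∀ {i} → IsMin σ i → IsMin π i
  min-antitone min j i∼j = min j (finer i∼j)

  max-antitone : ∀ {i} → IsMax σ i → IsMax π i
  max-antitone max j i∼j = max j (finer i∼j)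

open _≪_

abstract
  _≪?_ : (π σ : NC n) → Dec (π ≪ σ)
  π ≪? σ = map′ (λ (f , e) → mk≪ (f _ _) (e _ _)) (λ h → (λ _ _ → finer h) , λ _ _ → ends h)
    (Fin.all? (λ i → Fin.all? λ j → _∼?_ π i j →-dec _∼?_ σ i j) ×-dec
     (Fin.all? λ a → Fin.all? λ b →
       isMin? σ a →-dec isMax? σ b →-dec _∼?_ σ a b →-dec _∼?_ π a b))

≪⇒≤ : {π σ : NC n} → π ≪ σ → π ≤ σ
≪⇒≤ {π = π} {σ} π≪σ = ⊆⇒≤ π σ λ i → ∈block ∘ finer π≪σ ∘ in-block

≪-refl : (π : NC n) → π ≪ π
≪-refl π = mk≪ id λ _ _ → id

≪-trans : {π ρ σ : NC n} → π ≪ ρ → ρ ≪ σ → π ≪ σ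
≪-trans π≪ρ ρ≪σ = mk≪ (finer ρ≪σ ∘ finer π≪ρ) λ min max a∼b →
  ends π≪ρ (min-antitone ρ≪σ min) (max-antitone ρ≪σ max) (ends ρ≪σ min max a∼b)

≪-antisym : {π σ : NC n} → π ≪ σ → σ ≪ π → π ≡ σ
≪-antisym π≪σ σ≪π = ∼-ext (finer π≪σ) (finer σ≪π)

-- A block of σ is a union of blocks of π, and by hypothesis the minimum of each of these is the
-- minimum of the block of σ. So there is only one of them.
≪-sameMin : {π σ : NC n} → π ≪ σ → (∀ i → IsMin π i → IsMin σ i) → π ≡ σ
≪-sameMin {π = π} {σ} π≪σ mins = ∼-ext (finer π≪σ) λ {i} {j} i∼j →
  let k , i∼k , k-min = min-of π i
      l , j∼l , l-min = min-of π j
      k∼l = ∼-trans σ (∼-sym σ (finer π≪σ i∼k)) (∼-trans σ i∼j (finer π≪σ j∼l))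
      k≡l = Fin.≤-antisym (mins k k-min l k∼l) (mins l l-min k (∼-sym σ k∼l))
  in ∼-trans π (subst (i ∼[ π ]_) k≡l i∼k) (∼-sym π j∼l)

-- Cutting and merging blocks at the least new minimum

-- In the notation above, upper is σ′ and lower is π′.
module Cut {π σ : NC n} (π≪σ : π ≪ σ) (v : Fin n)
  (v-min : IsMin π v) (v-¬min : ¬ IsMin σ v)
  (v-least : ∀ u → u Fin.< v → IsMin π u → IsMin σ u) where

  private
    -- The block of σ through v runs from p to z, the block of π through v from v to w.
    p z w : Fin n
    p = proj₁ (min-of σ v)
    z = proj₁ (max-of σ v)
    w = proj₁ (max-of π v)

    v∼p : v ∼[ σ ] p
    v∼p = proj₁ (proj₂ (min-of σ v))
    p-min : IsMin σ p
    p-min = proj₂ (proj₂ (min-of σ v))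
    v∼z : v ∼[ σ ] z
    v∼z = proj₁ (proj₂ (max-of σ v))
    z-max : IsMax σ z
    z-max = proj₂ (proj₂ (max-of σ v))
    v∼w : v ∼[ π ] w
    v∼w = proj₁ (proj₂ (max-of π v))
    w-max : IsMax π w
    w-max = proj₂ (proj₂ (max-of π v))

    -- This block of π encloses the one of v: the two are different, and p < v ≤ w < z.
    p∼z : p ∼[ π ] z
    p∼z = ends π≪σ p-min z-max (∼-trans σ (∼-sym σ v∼p) v∼z)

    p≢v : p ≢ v
    p≢v p≡v = v-¬min (subst (IsMin σ) p≡v p-min)

    p<v : p Fin.< v
    p<v = Fin.≤∧≢⇒< (p-min v (∼-sym σ v∼p)) p≢v

    v≁p : ¬ v ∼[ π ] p
    v≁p v∼p = ℕ.<⇒≱ p<v (v-min p v∼p)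

    v≁z : ¬ v ∼[ π ] z
    v≁z v∼z = v≁p (∼-trans π v∼z (∼-sym π p∼z))

    w≤z : w Fin.≤ z
    w≤z = z-max w (∼-trans σ (∼-sym σ v∼z) (finer π≪σ v∼w))

    w<z : w Fin.< z
    w<z = Fin.≤∧≢⇒< w≤z λ w≡z → v≁z (subst (v ∼[ π ]_) w≡z v∼w)

  Inside : Pred (Fin n) _
  Inside i = v Fin.≤ i × i Fin.≤ w

  private
    inside? : Decidable Inside
    inside? i = (v Fin.≤? i) ×-dec (i Fin.≤? w)

    v-inside : Inside v
    v-inside = ℕ.≤-refl , w-max v (∼-sym π v∼w)
    w-inside : Inside w
    w-inside = v-min w v∼w , ℕ.≤-refl
    p-outside : ¬ Inside p
    p-outside (v≤p , _) = ℕ.<⇒≱ p<v v≤p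
    z-outside : ¬ Inside z
    z-outside (_ , z≤w) = ℕ.<⇒≱ w<z z≤w

  -- A block meeting both [v , w] and its complement, and not containing v, would cross v ∼ w.
  separated : (ρ : NC n) → (∀ {i j} → i ∼[ π ] j → i ∼[ ρ ] j) →
              ∀ {i j} → Inside i → ¬ Inside j → i ∼[ ρ ] j → v ∼[ ρ ] i
  separated ρ π≤ρ {i} {j} (v≤i , i≤w) j-out i∼j with Fin.<-cmp v i | Fin.<-cmp i w
  ... | tri≈ _ refl _ | _ = ∼-refl ρ
  ... | tri> _ _ i<v  | _ = contradiction v≤i (ℕ.<⇒≱ i<v)
  ... | tri< _ _ _    | tri≈ _ refl _ = π≤ρ v∼w
  ... | tri< _ _ _    | tri> _ _ w<i  = contradiction i≤w (ℕ.<⇒≱ w<i)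
  ... | tri< v<i _ _  | tri< i<w _ _ with Fin.<-cmp j v | Fin.<-cmp w j
  ... | tri≈ _ refl _ | _ = contradiction v-inside j-out
  ... | tri< j<v _ _  | _ =
    ∼-trans ρ (∼-sym ρ (∼-noncrossing ρ j<v v<i i<w (∼-sym ρ i∼j) (π≤ρ v∼w))) (∼-sym ρ i∼j)
  ... | tri> _ _ v<j  | tri≈ _ refl _ = contradiction w-inside j-out
  ... | tri> _ _ v<j  | tri> _ _ j<w  = contradiction (ℕ.<⇒≤ v<j , ℕ.<⇒≤ j<w) j-out
  ... | tri> _ _ v<j  | tri< w<j _ _  = ∼-noncrossing ρ v<i i<w w<j (π≤ρ v∼w) i∼j

  private
    -- σ cut along the interval [v , w]. By `separated` only the block of v is really cut: its inner
    -- part runs from v to w, and its outer part keeps the ends p and z.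
    Split : Rel (Fin n) _
    Split i j = i ∼[ σ ] j × (Inside i → Inside j) × (Inside j → Inside i)

    -- Intervals are convex: if a and c are inside, so is b between them; if b and d are inside, so
    -- is c, and with c also a.
    split-noncrossing : ∀ {a b c d} → a Fin.< b → b Fin.< c → c Fin.< d → Split a c → Split b d → Split a b
    split-noncrossing a<b b<c c<d (a∼c , ac , ca) (b∼d , bd , db) =
      ∼-noncrossing σ a<b b<c c<d a∼c b∼d ,
      (λ a-in → ℕ.≤-trans (proj₁ a-in) (ℕ.<⇒≤ a<b) , ℕ.≤-trans (ℕ.<⇒≤ b<c) (proj₂ (ac a-in))) ,
      λ b-in → ca (ℕ.≤-trans (proj₁ b-in) (ℕ.<⇒≤ b<c) , ℕ.≤-trans (ℕ.<⇒≤ c<d) (proj₂ (bd b-in)))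

    split? : Binary.Decidable Split
    split? i j = _∼?_ σ i j ×-dec (inside? i →-dec inside? j) ×-dec (inside? j →-dec inside? i)

    split-isEquivalence : IsEquivalence Split
    split-isEquivalence = record
      { refl  = ∼-refl σ , id , id
      ; sym   = λ (s , f , g) → ∼-sym σ s , g , f
      ; trans = λ (s , f , g) (s′ , f′ , g′) → ∼-trans σ s s′ , f′ ∘ f , g ∘ g′
      }

    module Upper = FromEquivalence split? split-isEquivalence split-noncrossing

  upper : NC n
  upper = Upper.partition

  private
    ∼upper : ∀ {i j} → i ∼[ σ ] j → (Inside i → Inside j) → (Inside j → Inside i) → i ∼[ upper ] j
    ∼upper s f g = Upper.∼⁺ (s , f , g)

  upper-min-v : IsMin upper v
  upper-min-v j v∼j = proj₁ (proj₁ (proj₂ (Upper.∼⁻ v∼j)) v-inside)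

  upper-min⁺ : ∀ {i} → IsMin σ i → IsMin upper i
  upper-min⁺ min j i∼j = min j (proj₁ (Upper.∼⁻ i∼j))

  -- With `upper-min-v` and `upper-min⁺`: the cut creates the minimum v and no other, since the
  -- outer part of the cut block still contains p.
  upper-min⁻ : ∀ {i} → i ≢ v → IsMin upper i → IsMin σ i
  upper-min⁻ {i} i≢v i-min j i∼j with inside? i | inside? j
  ... | yes i-in | yes j-in = i-min j (∼upper i∼j (λ _ → j-in) (λ _ → i-in))
  ... | no i-out | no j-out = i-min j (∼upper i∼j (⊥-elim ∘ i-out) (⊥-elim ∘ j-out))
  ... | yes i-in | no j-out = contradiction (Fin.≤-antisym (i-min v i∼v) (proj₁ i-in)) i≢v
    where
    i∼v : i ∼[ upper ] v
    i∼v = ∼upper (∼-sym σ (separated σ (finer π≪σ) i-in j-out i∼j)) (λ _ → v-inside) (λ _ → i-in)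
  ... | no i-out | yes j-in = Fin.≤-trans (i-min p i∼p) (p-min j p∼j)
    where
    v∼j : v ∼[ σ ] j
    v∼j = separated σ (finer π≪σ) j-in i-out (∼-sym σ i∼j)
    p∼j : p ∼[ σ ] j
    p∼j = ∼-trans σ (∼-sym σ v∼p) v∼j
    i∼p : i ∼[ upper ] p
    i∼p = ∼upper (∼-trans σ i∼j (∼-sym σ p∼j)) (⊥-elim ∘ i-out) (⊥-elim ∘ p-outside)

  private
    -- The mirror image of `upper-min⁻`, with w and z in the roles of v and p.
    upper-max⁻ : ∀ {i} → i ≢ w → IsMax upper i → IsMax σ i
    upper-max⁻ {i} i≢w i-max j i∼j with inside? i | inside? j
    ... | yes i-in | yes j-in = i-max j (∼upper i∼j (λ _ → j-in) (λ _ → i-in))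
    ... | no i-out | no j-out = i-max j (∼upper i∼j (⊥-elim ∘ i-out) (⊥-elim ∘ j-out))
    ... | yes i-in | no j-out = contradiction (Fin.≤-antisym (proj₂ i-in) (i-max w i∼w)) i≢w
      where
      i∼w : i ∼[ upper ] w
      i∼w = ∼upper (∼-trans σ (∼-sym σ (separated σ (finer π≪σ) i-in j-out i∼j)) (finer π≪σ v∼w))
              (λ _ → w-inside) (λ _ → i-in)
    ... | no i-out | yes j-in = Fin.≤-trans (z-max j z∼j) (i-max z i∼z)
      where
      v∼j : v ∼[ σ ] j
      v∼j = separated σ (finer π≪σ) j-in i-out (∼-sym σ i∼j)
      z∼j : z ∼[ σ ] j
      z∼j = ∼-trans σ (∼-sym σ v∼z) v∼j
      i∼z : i ∼[ upper ] z
      i∼z = ∼upper (∼-trans σ i∼j (∼-sym σ z∼j)) (⊥-elim ∘ i-out) (⊥-elim ∘ z-outside)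

  -- By `separated`, a block of σ with just one end in [v , w] would be the block of v. But its
  -- minimum is at most v and different from v, and its maximum is at least z, which lies beyond w.
  upper≪σ : upper ≪ σ
  upper≪σ = mk≪ (proj₁ ∘ Upper.∼⁻) λ {a} {b} a-min b-max a∼b → ∼upper a∼b
    (λ a-in → case inside? b of λ
      { (yes b-in) → b-in
      ; (no b-out) → contradiction
          (subst (IsMin σ)
            (Fin.≤-antisym
              (a-min v (∼-sym σ (separated σ (finer π≪σ) a-in b-out a∼b))) (proj₁ a-in))
            a-min)
          v-¬min })
    (λ b-in → case inside? a of λ
      { (yes a-in) → a-in
      ; (no a-out) → contradiction
          (ℕ.≤-trans (b-max z (∼-trans σ (∼-sym σ (separated σ (finer π≪σ) b-in a-out (∼-sym σ a∼b))) v∼z))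
            (proj₂ b-in))
          (ℕ.<⇒≱ w<z) })

  -- As v is a minimum of ρ, π ≪ ρ makes the block of v in ρ end where it ends in π, at w. So this
  -- block stays within [v , w], and by `separated` no other block of ρ leaves or enters the
  -- interval.
  ≪upper : ∀ {ρ} → π ≪ ρ → ρ ≪ σ → IsMin ρ v → ρ ≪ upper
  ≪upper {ρ} π≪ρ ρ≪σ v-minρ = mk≪ (λ i∼j → ∼upper (finer ρ≪σ i∼j) (stays i∼j) (stays (∼-sym ρ i∼j))) endsρ
    where
    w-maxρ : IsMax ρ w
    w-maxρ j w∼j =
      let k , v∼k , k-max = max-of ρ v
      in ℕ.≤-trans (k-max j (∼-trans ρ (∼-sym ρ v∼k) (∼-trans ρ (finer π≪ρ v∼w) w∼j)))
                   (w-max k (∼-trans π (∼-sym π v∼w) (ends π≪ρ v-minρ k-max v∼k)))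
    stays : ∀ {i j} → i ∼[ ρ ] j → Inside i → Inside j
    stays {i} {j} i∼j i-in with inside? j
    ... | yes j-in = j-in
    ... | no j-out = v-minρ j v∼j , w-maxρ j (∼-trans ρ (∼-sym ρ (finer π≪ρ v∼w)) v∼j)
      where
      v∼j : v ∼[ ρ ] j
      v∼j = ∼-trans ρ (separated ρ (finer π≪ρ) i-in j-out i∼j) i∼j
    endsρ : ∀ {a b} → IsMin upper a → IsMax upper b → a ∼[ upper ] b → a ∼[ ρ ] b
    -- The ends v and w belong to one block of `upper`, which rules out the mixed cases; the ends of
    -- any other block are also ends of a block of σ.
    endsρ {a} {b} a-min b-max a∼b with a Fin.≟ v | b Fin.≟ w
    ... | yes refl | yes refl = finer π≪ρ v∼w
    ... | no a≢v   | no b≢w   =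
      ends ρ≪σ (upper-min⁻ a≢v a-min) (upper-max⁻ b≢w b-max) (proj₁ (Upper.∼⁻ a∼b))
    ... | yes refl | no b≢w   = contradiction
      (Fin.≤-antisym (proj₂ b-in)
        (b-max w (∼-trans upper (∼-sym upper a∼b)
          (∼upper (finer π≪σ v∼w) (λ _ → w-inside) (λ _ → v-inside))))) b≢w
      where
      b-in : Inside b
      b-in = proj₁ (proj₂ (Upper.∼⁻ a∼b)) v-inside
    ... | no a≢v   | yes refl = contradiction
      (Fin.≤-antisym
        (a-min v (∼-trans upper a∼b
          (∼upper (∼-sym σ (finer π≪σ v∼w)) (λ _ → v-inside) (λ _ → w-inside))))
        (proj₁ a-in)) a≢v
      where
      a-in : Inside a
      a-in = proj₂ (proj₂ (Upper.∼⁻ a∼b)) w-inside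

  -- The blocks of v and p are merged in lower; since v is least, the block of
  -- p is the innermost one around v within the same block of σ.
  private
    Merged : Pred (Fin n) _
    Merged i = v ∼[ π ] i ⊎ p ∼[ π ] i

    merged? : Decidable Merged
    merged? i = _∼?_ π v i ⊎-dec _∼?_ π p i

    merged-closed : ∀ {i j} → i ∼[ π ] j → Merged i → Merged j
    merged-closed i∼j (inj₁ v∼i) = inj₁ (∼-trans π v∼i i∼j)
    merged-closed i∼j (inj₂ p∼i) = inj₂ (∼-trans π p∼i i∼j)

    merged⇒∼v : ∀ {i} → Merged i → v ∼[ σ ] i
    merged⇒∼v (inj₁ v∼i) = finer π≪σ v∼i
    merged⇒∼v (inj₂ p∼i) = ∼-trans σ v∼p (finer π≪σ p∼i)

    -- Since σ is non-crossing, b and d lie in its block from p to z. If c is in the block of p,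
    -- then b ∼ d would cross c ∼ z unless d is z or b is in that block too; if c is in the block of
    -- v, the minimum of the block of b decides.
    merged-noncrossing : ∀ {a b c d} → a Fin.< b → b Fin.< c → c Fin.< d →
                         Merged a → Merged c → b ∼[ π ] d → Merged b
    merged-noncrossing {a} {b} {c} {d} a<b b<c c<d A C b∼d = by-cases C
      where
      a∼b : a ∼[ σ ] b
      a∼b = ∼-noncrossing σ a<b b<c c<d
              (∼-trans σ (∼-sym σ (merged⇒∼v A)) (merged⇒∼v C)) (finer π≪σ b∼d)
      v∼b : v ∼[ σ ] b
      v∼b = ∼-trans σ (merged⇒∼v A) a∼b
      by-cases : Merged c → Merged b
      by-cases (inj₂ p∼c) with d Fin.≟ z
      ... | yes refl = merged-closed (∼-sym π b∼d) (inj₂ p∼z)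
      ... | no d≢z   =
        inj₂ (∼-trans π p∼c (∼-sym π (∼-noncrossing π b<c c<d d<z b∼d (∼-trans π (∼-sym π p∼c) p∼z))))
        where
        d<z : d Fin.< z
        d<z = Fin.≤∧≢⇒< (z-max d (∼-trans σ (∼-sym σ v∼z) (∼-trans σ v∼b (finer π≪σ b∼d)))) d≢z
      -- Leastness of v enters here: a minimum x before v is also a minimum of σ, hence p. If x is
      -- after v, then v < b < c < d would be a crossing unless v ∼ b.
      by-cases (inj₁ v∼c) with x , b∼x , x-min ← min-of π b with Fin.<-cmp x v
      ... | tri≈ _ refl _ = inj₁ (∼-sym π b∼x)
      ... | tri< x<v _ _  = inj₂ (subst (_∼[ π ] b) x≡p (∼-sym π b∼x))
        where
        p∼x : p ∼[ σ ] x
        p∼x = ∼-trans σ (∼-sym σ v∼p) (∼-trans σ v∼b (finer π≪σ b∼x))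
        x≡p : x ≡ p
        x≡p = Fin.≤-antisym (v-least x x<v x-min p (∼-sym σ p∼x)) (p-min x p∼x)
      ... | tri> _ _ v<x  =
        inj₁ (∼-noncrossing π (ℕ.<-≤-trans v<x (x-min b (∼-sym π b∼x))) b<c c<d v∼c b∼d)

    Join : Rel (Fin n) _
    Join i j = i ∼[ π ] j ⊎ Merged i × Merged j

    join-trans : ∀ {i j k} → Join i j → Join j k → Join i k
    join-trans (inj₁ s)       (inj₁ t)       = inj₁ (∼-trans π s t)
    join-trans (inj₁ s)       (inj₂ (B , C)) = inj₂ (merged-closed (∼-sym π s) B , C)
    join-trans (inj₂ (A , B)) (inj₁ t)       = inj₂ (A , merged-closed t B)
    join-trans (inj₂ (A , _)) (inj₂ (_ , C)) = inj₂ (A , C)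

    join-noncrossing : ∀ {a b c d} → a Fin.< b → b Fin.< c → c Fin.< d → Join a c → Join b d → Join a b
    join-noncrossing a<b b<c c<d (inj₁ s) (inj₁ t) = inj₁ (∼-noncrossing π a<b b<c c<d s t)
    join-noncrossing a<b b<c c<d (inj₂ (A , _)) (inj₂ (B , _)) = inj₂ (A , B)
    join-noncrossing a<b b<c c<d (inj₂ (A , C)) (inj₁ t) =
      inj₂ (A , merged-noncrossing a<b b<c c<d A C t)
    join-noncrossing {a} {b} {c} {d} a<b b<c c<d (inj₁ s) (inj₂ (B , D)) = inj₂ (merged-a , B)
      where
      b∼d : b ∼[ σ ] d
      b∼d = ∼-trans σ (∼-sym σ (merged⇒∼v B)) (merged⇒∼v D)
      v∼a : v ∼[ σ ] a
      v∼a = ∼-trans σ (merged⇒∼v B) (∼-sym σ (∼-noncrossing σ a<b b<c c<d (finer π≪σ s) b∼d))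
      -- Nothing in this block of σ precedes p, so unless a is p the pattern p < a < b < c falls
      -- under `merged-noncrossing`.
      merged-a : Merged a
      merged-a with p Fin.≟ a
      ... | yes refl = inj₂ (∼-refl π)
      ... | no p≢a   = merged-noncrossing
        (Fin.≤∧≢⇒< (p-min a (∼-trans σ (∼-sym σ v∼p) v∼a)) p≢a) a<b b<c (inj₂ (∼-refl π)) B s

    join? : Binary.Decidable Join
    join? i j = _∼?_ π i j ⊎-dec (merged? i ×-dec merged? j)

    join-isEquivalence : IsEquivalence Join
    join-isEquivalence = record
      { refl  = inj₁ (∼-refl π)
      ; sym   = [ inj₁ ∘ ∼-sym π , (λ (A , B) → inj₂ (B , A)) ]′
      ; trans = join-trans
      }

    module Lower = FromEquivalence join? join-isEquivalence join-noncrossing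

  lower : NC n
  lower = Lower.partition

  private
    ∼lower : ∀ {i j} → i ∼[ π ] j → i ∼[ lower ] j
    ∼lower = Lower.∼⁺ ∘ inj₁

    v∼p-lower : v ∼[ lower ] p
    v∼p-lower = Lower.∼⁺ (inj₂ (inj₁ (∼-refl π) , inj₂ (∼-refl π)))

  lower-¬min-v : ¬ IsMin lower v
  lower-¬min-v min = ℕ.<⇒≱ p<v (min p v∼p-lower)

  lower-min⁻ : ∀ {i} → IsMin lower i → IsMin π i
  lower-min⁻ min j i∼j = min j (∼lower i∼j)

  -- The merged block starts at p, which is a minimum of π already, so v is the only minimum that
  -- the merge loses.
  lower-min⁺ : ∀ {i} → i ≢ v → IsMin π i → IsMin lower i
  lower-min⁺ {i} i≢v min j i∼j with Lower.∼⁻ i∼j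
  ... | inj₁ s = min j s
  ... | inj₂ (inj₁ v∼i , _) =
    contradiction (Fin.≤-antisym (min v (∼-sym π v∼i)) (v-min i v∼i)) i≢v
  ... | inj₂ (inj₂ p∼i , B) =
    ℕ.≤-trans (min p (∼-sym π p∼i)) (p-min j (∼-trans σ (∼-sym σ v∼p) (merged⇒∼v B)))

  -- The only block that changes runs from p to z, and these are in one block of π.
  π≪lower : π ≪ lower
  π≪lower = mk≪ ∼lower endsπ
    where
    endsπ : ∀ {a b} → IsMin lower a → IsMax lower b → a ∼[ lower ] b → a ∼[ π ] b
    endsπ {a} {b} a-min b-max a∼b with Lower.∼⁻ a∼b
    ... | inj₁ s = s
    ... | inj₂ (A , B) = subst (_∼[ π ] b) (sym a≡p) (subst (p ∼[ π ]_) (sym b≡z) p∼z)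
      where
      a≡p : a ≡ p
      a≡p = Fin.≤-antisym (a-min p (Lower.∼⁺ (inj₂ (A , inj₂ (∼-refl π)))))
                          (p-min a (∼-trans σ (∼-sym σ v∼p) (merged⇒∼v A)))
      b≡z : b ≡ z
      b≡z = Fin.≤-antisym (z-max b (∼-trans σ (∼-sym σ v∼z) (merged⇒∼v B)))
                          (b-max z (Lower.∼⁺ (inj₂ (B , inj₂ p∼z))))

  -- As v is not a minimum of ρ, its block in ρ starts at some k < v. This k is a minimum of π, by
  -- leastness of v then one of σ, and therefore p. So ρ joins v and p as well.
  lower≪ : ∀ {ρ} → π ≪ ρ → ρ ≪ σ → ¬ IsMin ρ v → lower ≪ ρ
  lower≪ {ρ} π≪ρ ρ≪σ v-¬minρ = mk≪ (finerρ ∘ Lower.∼⁻) λ min max → ∼lower ∘ ends π≪ρ min max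
    where
    v∼pρ : v ∼[ ρ ] p
    v∼pρ with k , v∼k , k-min ← min-of ρ v = subst (v ∼[ ρ ]_) k≡p v∼k
      where
      k≢v : k ≢ v
      k≢v refl = v-¬minρ k-min
      k<v : k Fin.< v
      k<v = Fin.≤∧≢⇒< (k-min v (∼-sym ρ v∼k)) k≢v
      p∼k : p ∼[ σ ] k
      p∼k = ∼-trans σ (∼-sym σ v∼p) (finer ρ≪σ v∼k)
      k≡p : k ≡ p
      k≡p = Fin.≤-antisym (v-least k k<v (min-antitone π≪ρ k-min) p (∼-sym σ p∼k)) (p-min k p∼k)
    v∼ρ : ∀ {i} → Merged i → v ∼[ ρ ] i
    v∼ρ (inj₁ v∼i) = finer π≪ρ v∼i
    v∼ρ (inj₂ p∼i) = ∼-trans ρ v∼pρ (finer π≪ρ p∼i)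
    finerρ : ∀ {i j} → Join i j → i ∼[ ρ ] j
    finerρ (inj₁ s)       = finer π≪ρ s
    finerρ (inj₂ (A , B)) = ∼-trans ρ (∼-sym ρ (v∼ρ A)) (v∼ρ B)

-- Counting

-- Serves for sums and products in a ring and for sums of natural numbers.
module ListFold {c ℓ} (M : CommutativeMonoid c ℓ) where
  open CommutativeMonoid M
    renaming (refl to ≈-refl; sym to ≈-sym; trans to ≈-trans)
  open import Algebra.Properties.CommutativeSemigroup commutativeSemigroup using (interchange)

  fold : List Carrier → Carrier
  fold = foldr _∙_ ε

  fold-cong : {f g : A → Carrier} (xs : List A) → (∀ {x} → x ∈ˡ xs → f x ≈ g x) →
              fold (map f xs) ≈ fold (map g xs)
  fold-cong []       e = ≈-refl
  fold-cong (x ∷ xs) e = ∙-cong (e (here refl)) (fold-cong xs (e ∘ there))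

  fold-mapWith∈ : (xs : List A) {f : ∀ {x} → x ∈ˡ xs → Carrier} {g : A → Carrier} →
                  (∀ {x} (x∈ : x ∈ˡ xs) → f x∈ ≈ g x) → fold (mapWith∈ xs f) ≈ fold (map g xs)
  fold-mapWith∈ []       e = ≈-refl
  fold-mapWith∈ (x ∷ xs) e = ∙-cong (e (here refl)) (fold-mapWith∈ xs (e ∘ there))

  fold-ε : {f : A → Carrier} (xs : List A) → (∀ {x} → x ∈ˡ xs → f x ≈ ε) → fold (map f xs) ≈ ε
  fold-ε []       e = ≈-refl
  fold-ε (x ∷ xs) e = ≈-trans (∙-cong (e (here refl)) (fold-ε xs (e ∘ there))) (identityˡ ε)

  fold-single : {f : A → Carrier} {xs : List A} {x : A} → Unique xs → x ∈ˡ xs →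
                (∀ {y} → y ∈ˡ xs → y ≢ x → f y ≈ ε) → fold (map f xs) ≈ f x
  fold-single {xs = x ∷ xs} (x∉ ∷ _) (here refl) e =
    ≈-trans (∙-congˡ (fold-ε xs λ y∈ → e (there y∈) (All.lookup x∉ y∈ ∘ sym))) (identityʳ _)
  fold-single {xs = y ∷ xs} (y∉ ∷ u) (there x∈) e =
    ≈-trans (∙-cong (e (here refl) (All.lookup y∉ x∈)) (fold-single u x∈ (e ∘ there))) (identityˡ _)

  fold-∙ : (f g : A → Carrier) (xs : List A) →
           fold (map (λ x → f x ∙ g x) xs) ≈ fold (map f xs) ∙ fold (map g xs)
  fold-∙ f g []       = ≈-sym (identityˡ ε)
  fold-∙ f g (x ∷ xs) = ≈-trans (∙-congˡ (fold-∙ f g xs)) (interchange _ _ _ _)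

  -- Extension by zero: it turns a sum over an interval into one over all of NC(n).
  fold-filter : ∀ {p} {P : Pred A p} (P? : Decidable P) {f : A → Carrier} (xs : List A) →
                (∀ {x} → ¬ P x → f x ≈ ε) → fold (map f (filter P? xs)) ≈ fold (map f xs)
  fold-filter P? []       e = ≈-refl
  fold-filter P? (x ∷ xs) e with P? x
  ... | yes _ = ∙-congˡ (fold-filter P? xs e)
  ... | no ¬p = ≈-trans (fold-filter P? xs e) (≈-trans (≈-sym (identityˡ _)) (∙-congʳ (≈-sym (e ¬p))))

module ℕ-Fold = ListFold ℕ.+-0-commutativeMonoid

𝟙 : {A : Set a} → Dec A → ℕ
𝟙 a? = if does a? then 1 else 0

𝟙-true : {A : Set a} (a? : Dec A) → A → 𝟙 a? ≡ 1
𝟙-true a? a = cong (if_then 1 else 0) (dec-true a? a)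

𝟙-false : {A : Set a} (a? : Dec A) → ¬ A → 𝟙 a? ≡ 0
𝟙-false a? ¬a = cong (if_then 1 else 0) (dec-false a? ¬a)

𝟙-cong : {A B : Set a} (a? : Dec A) (b? : Dec B) → (A → B) → (B → A) → 𝟙 a? ≡ 𝟙 b?
𝟙-cong a? b? f g = cong (if_then 1 else 0) (does-⇔ (mk⇔ f g) a? b?)

count : {P : Pred (Fin n) ℓ} → Decidable P → ℕ
count P? = ∑ᶠ λ i → 𝟙 (P? i)

module _ {P Q : Pred (Fin n) ℓ} (P? : Decidable P) (Q? : Decidable Q) where

  count-cong : (∀ {i} → P i → Q i) → (∀ {i} → Q i → P i) → count P? ≡ count Q?
  count-cong f g = sum-cong-≗ λ i → 𝟙-cong (P? i) (Q? i) f g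

count-suc : {P Q : Pred (Fin n) ℓ} (P? : Decidable P) (Q? : Decidable Q) (v : Fin n) → P v → ¬ Q v →
            (∀ {i} → i ≢ v → P i → Q i) → (∀ {i} → i ≢ v → Q i → P i) → count P? ≡ suc (count Q?)
count-suc P? Q? zero Pv ¬Qv f g =
  cong₂ ℕ._+_ (𝟙-true (P? zero) Pv)
    (cong₂ ℕ._+_ (sym (𝟙-false (Q? zero) ¬Qv))
      (count-cong (P? ∘ suc) (Q? ∘ suc) (f λ ()) (g λ ())))
count-suc P? Q? (suc v) Pv ¬Qv f g = trans
  (cong₂ ℕ._+_ (𝟙-cong (P? zero) (Q? zero) (f λ ()) (g λ ()))
    (count-suc (P? ∘ suc) (Q? ∘ suc) v Pv ¬Qv
      (λ i≢v → f (i≢v ∘ Fin.suc-injective)) (λ i≢v → g (i≢v ∘ Fin.suc-injective))))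
  (ℕ.+-suc (𝟙 (Q? zero)) _)

count-none : {P : Pred (Fin n) ℓ} (P? : Decidable P) → (∀ i → ¬ P i) → count P? ≡ 0
count-none {n = n} P? none = trans (sum-cong-≗ λ i → 𝟙-false (P? i) (none i)) (sum-replicate-zero n)

count-single : {P : Pred (Fin n) ℓ} (P? : Decidable P) (v : Fin n) → P v → (∀ {i} → P i → i ≡ v) →
               count P? ≡ 1
count-single P? v Pv only = trans
  (count-suc P? (λ i → P? i ×-dec ¬? (i Fin.≟ v)) v Pv (λ (_ , v≢v) → v≢v refl)
    (λ i≢v Pi → Pi , i≢v) (λ _ → proj₁))
  (cong suc (count-none (λ i → P? i ×-dec ¬? (i Fin.≟ v)) λ i (Pi , i≢v) → i≢v (only Pi)))

count-elements : (W : Subset n) {P : Pred (Fin n) ℓ} (P? : Decidable P) →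
                 count (P? ∘ elements W) ≡ count (λ i → (i ∈? W) ×-dec P? i)
count-elements []            P? = refl
count-elements (inside  ∷ W) P? = cong (𝟙 (P? zero) ℕ.+_) (count-elements W (P? ∘ suc))
count-elements (outside ∷ W) P? = count-elements W (P? ∘ suc)

sum-∑ᶠ : (f : A → Fin n → ℕ) (xs : List A) →
         ℕ-Fold.fold (map (λ x → ∑ᶠ (f x)) xs) ≡ ∑ᶠ (λ i → ℕ-Fold.fold (map (λ x → f x i) xs))
sum-∑ᶠ {n = n} f []       = sym (sum-replicate-zero n)
sum-∑ᶠ         f (x ∷ xs) =
  trans (cong (∑ᶠ (f x) ℕ.+_) (sum-∑ᶠ f xs)) (sym (∑-distrib-+ (f x) _))

-- Double counting: with the sums exchanged, each i contributes through its own block alone, which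
-- the deduplicated list contains once.
sum-blocks : (π : NC n) {P : Pred (Fin n) ℓ} (P? : Decidable P) →
             ℕ-Fold.fold (map (λ W → count (λ i → (i ∈? W) ×-dec P? i)) (blocks π)) ≡ count P?
sum-blocks π {P} P? = trans (sum-∑ᶠ (λ W i → 𝟙 ((i ∈? W) ×-dec P? i)) (blocks π)) (sum-cong-≗ at)
  where
  at : ∀ i → ℕ-Fold.fold (map (λ W → 𝟙 ((i ∈? W) ×-dec P? i)) (blocks π)) ≡ 𝟙 (P? i)
  at i = trans
    (ℕ-Fold.fold-single (Unique.deduplicate-! _≟ˢ_ _) (blockOf∈blocks π i)
      λ {W} W∈ W≢ → 𝟙-false ((i ∈? W) ×-dec P? i) λ (i∈W , _) → W≢ (∈block⇒≡ π W∈ i∈W))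
    (𝟙-cong ((i ∈? blockOf π i) ×-dec P? i) (P? i) proj₂ (covers π i ,_))

-- Each block has exactly one minimum.
#blocks≡count-min : (π : NC n) → #blocks π ≡ count (isMin? π)
#blocks≡count-min π = trans (length≡ (blocks π)) (trans
  (ℕ-Fold.fold-cong (blocks π) (λ W∈ → sym (one-min W∈)))
  (sum-blocks π (isMin? π)))
  where
  length≡ : (xs : List A) → length xs ≡ ℕ-Fold.fold (map (λ _ → 1) xs)
  length≡ []       = refl
  length≡ (_ ∷ xs) = cong suc (length≡ xs)
  one-min : ∀ {W} → W ∈ˡ blocks π → count (λ i → (i ∈? W) ×-dec isMin? π i) ≡ 1
  one-min W∈ with i , refl ← ∈blocks⁻ π W∈ with k , i∼k , k-min ← min-of π i =
    count-single (λ i′ → (i′ ∈? blockOf π i) ×-dec isMin? π i′) k (∈block i∼k , k-min)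
      λ {j} (j∈ , j-min) →
        let j∼k = ∼-trans π (∼-sym π (in-block j∈)) i∼k
        in Fin.≤-antisym (j-min k j∼k) (k-min j (∼-sym π j∼k))

NewMin : (π σ : NC n) → Pred (Fin n) _
NewMin π σ i = IsMin π i × ¬ IsMin σ i

newMin? : (π σ : NC n) → Decidable (NewMin π σ)
newMin? π σ i = isMin? π i ×-dec ¬? (isMin? σ i)

-- The exponent d; for π ≪ σ it is |π| - |σ|, since minima of σ are minima of π. As a count of
-- elements it splits into contributions of the blocks of σ.
rank : (π σ : NC n) → ℕ
rank π σ = count (newMin? π σ)

-- Restriction to a block

elements-surjective : (W : Subset n) {i : Fin n} → i ∈ W → ∃ λ k → elements W k ≡ i
elements-surjective (inside  ∷ W) {zero}  _ = zero , refl
elements-surjective (inside  ∷ W) {suc i} (there i∈) with k , refl ← elements-surjective W i∈ = suc k , refl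
elements-surjective (outside ∷ W) {suc i} (there i∈) with k , refl ← elements-surjective W i∈ = k , refl

elements-≤ : (W : Subset n) {i j : Fin ∣ W ∣} → i Fin.≤ j → elements W i Fin.≤ elements W j
elements-≤ W {i} {j} i≤j with i Fin.≟ j
... | yes refl = ℕ.≤-refl
... | no i≢j   = ℕ.<⇒≤ (elements-mono W (Fin.≤∧≢⇒< i≤j i≢j))

elements-cancel-≤ : (W : Subset n) {i j : Fin ∣ W ∣} → elements W i Fin.≤ elements W j → i Fin.≤ j
elements-cancel-≤ W {i} {j} e with i Fin.≤? j
... | yes i≤j = i≤j
... | no i≰j  = contradiction e (ℕ.<⇒≱ (elements-mono W (ℕ.≰⇒> i≰j)))

first-≤ : .{{_ : NonZero n}} (i : Fin n) → first n Fin.≤ i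
first-≤ {suc n} i = ℕ.z≤n

≤-last : .{{_ : NonZero n}} (i : Fin n) → i Fin.≤ last n
≤-last {suc n} i = Fin.≤fromℕ i

module _ (π : NC n) (W : Subset n) where

  ∼-↾⁺ : ∀ {i j} → elements W i ∼[ π ] elements W j → i ∼[ π ↾ W ] j
  ∼-↾⁺ {i} {j} (in-block j∈) =
    in-block (subst (j ∈_) (sym (blockOf-↾ π W i)) (∈pullback⁺ (elements W) _ j∈))

  ∼-↾⁻ : ∀ {i j} → i ∼[ π ↾ W ] j → elements W i ∼[ π ] elements W j
  ∼-↾⁻ {i} {j} (in-block j∈) =
    in-block (∈pullback⁻ (elements W) _ (subst (j ∈_) (blockOf-↾ π W i) j∈))

module Restriction {π σ : NC n} (π≤σ : ∀ {i j} → i ∼[ π ] j → i ∼[ σ ] j)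
                   {W : Subset n} (W∈ : W ∈ˡ blocks σ) where
  private
    instance
      nonZero : NonZero ∣ W ∣
      nonZero = block-nonZero σ W∈

    e : Fin ∣ W ∣ → Fin n
    e = elements W

    ∈W : ∀ {i j} → e i ∼[ σ ] j → j ∈ W
    ∈W {i} {j} (in-block j∈) = subst (j ∈_) (sym (∈block⇒≡ σ W∈ (elements∈ W i))) j∈

    same-block : ∀ i j → e i ∼[ σ ] e j
    same-block i j = in-block (subst (e j ∈_) (∈block⇒≡ σ W∈ (elements∈ W i)) (elements∈ W j))

  first-isMin : IsMin σ (e (first ∣ W ∣))
  first-isMin j s with k , refl ← elements-surjective W (∈W s) = elements-≤ W (first-≤ k)

  last-isMax : IsMax σ (e (last ∣ W ∣))
  last-isMax j s with k , refl ← elements-surjective W (∈W s) = elements-≤ W (≤-last k)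

  -- The first and last elements of the restriction are the minimum and the maximum of W, so
  -- irreducibility is the condition on ends for the single block W.
  ≪⇒irreducible : π ≪ σ → Irreducible (π ↾ W)
  ≪⇒irreducible π≪σ = ∈block (∼-↾⁺ π W (ends π≪σ first-isMin last-isMax (same-block _ _)))

  irreducible⇒ends : Irreducible (π ↾ W) →
    ∀ {a b} → a ∈ W → IsMin σ a → IsMax σ b → a ∼[ σ ] b → a ∼[ π ] b
  irreducible⇒ends irr {a} {b} a∈W a-min b-max a∼b with k , refl ← elements-surjective W a∈W =
    subst (_∼[ π ] b) first≡a (subst (e (first ∣ W ∣) ∼[ π ]_) last≡b (∼-↾⁻ π W (in-block irr)))
    where
    first≡a : e (first ∣ W ∣) ≡ a
    first≡a = Fin.≤-antisym (first-isMin a (same-block _ k)) (a-min _ (same-block k _))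
    last≡b : e (last ∣ W ∣) ≡ b
    last≡b = Fin.≤-antisym (b-max _ (∼-trans σ (∼-sym σ a∼b) (same-block k _)))
                           (last-isMax b (∼-trans σ (same-block _ k) a∼b))

  isMin-↾⁺ : ∀ {i} → IsMin π (e i) → IsMin (π ↾ W) i
  isMin-↾⁺ min j i∼j = elements-cancel-≤ W (min (e j) (∼-↾⁻ π W i∼j))

  isMin-↾⁻ : ∀ {i} → IsMin (π ↾ W) i → IsMin π (e i)
  isMin-↾⁻ min j i∼j with k , refl ← elements-surjective W (∈W (π≤σ i∼j)) =
    elements-≤ W (min k (∼-↾⁺ π W i∼j))

  -- Of the minima of π in W exactly one, the first element of W, is a minimum of σ. It accounts for
  -- the `∸ 1` in the exponent of `uValue`.
  #blocks-↾ : #blocks (π ↾ W) ≡ suc (count (λ i → (i ∈? W) ×-dec newMin? π σ i))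
  #blocks-↾ = trans (#blocks≡count-min (π ↾ W)) (trans
    (count-suc (isMin? (π ↾ W)) (newMin? π σ ∘ e) (first ∣ W ∣)
      (λ j _ → first-≤ j) (λ (_ , ¬min) → ¬min first-isMin)
      (λ {i} i≢ min → isMin-↾⁻ min , λ min′ → i≢
        (Fin.≤-antisym (elements-cancel-≤ W (min′ _ (same-block i _))) (first-≤ i)))
      (λ _ (min , _) → isMin-↾⁺ min))
    (cong suc (count-elements W (newMin? π σ))))

-- The enumeration of NC(n)

allVecs-unique : {xs : List A} → Unique xs → ∀ n → Unique (allVecs xs n)
allVecs-unique u zero    = [] ∷ []
allVecs-unique u (suc n) = Unique.cartesianProductWith⁺ _∷_ ∷-injective u (allVecs-unique u n)

∈-allVecs : {xs : List A} → (∀ x → x ∈ˡ xs) → (v : Vec A n) → v ∈ˡ allVecs xs n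
∈-allVecs all []      = here refl
∈-allVecs all (x ∷ v) = ∈-cartesianProductWith⁺ _∷_ (all x) (∈-allVecs all v)

allSubsets-unique : ∀ n → Unique (allSubsets n)
allSubsets-unique = allVecs-unique (((λ ()) ∷ []) ∷ [] ∷ [])

∈-allSubsets : (W : Subset n) → W ∈ˡ allSubsets n
∈-allSubsets = ∈-allVecs λ { inside → here refl ; outside → there (here refl) }

isNC? : (r : Vec (Subset n) n) → Dec (IsPartition r × NonCrossing r)
isNC? r = isPartition? r ×-dec nonCrossing? r

map-mapMaybe : {B : Set a} {P : Pred A ℓ} (P? : Decidable P) (f : ∀ {x} → P x → B) (g : B → A) →
               (∀ {x} (px : P x) → g (f px) ≡ x) → (xs : List A) →
               map g (mapMaybe (λ x → Maybe.map f (dec⇒maybe (P? x))) xs) ≡ filter P? xs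
map-mapMaybe P? f g e []       = refl
map-mapMaybe P? f g e (x ∷ xs) with P? x
... | yes px = cong₂ _∷_ (e px) (map-mapMaybe P? f g e xs)
... | no  _  = map-mapMaybe P? f g e xs

-- On the underlying vectors the enumeration is a plain filter, where uniqueness and completeness
-- are easy to see.
map-blockVec : (rs : List (Vec (Subset n) n)) → map blockVec (mapMaybe toNC rs) ≡ filter isNC? rs
map-blockVec = map-mapMaybe isNC? (λ (p , q) → mkNC _ p q) blockVec (λ _ → refl)

allNC-unique : ∀ n → Unique (allNC n)
allNC-unique n = Unique.map⁻ (subst Unique (sym (map-blockVec rs))
  (Unique.filter⁺ isNC? (allVecs-unique (allSubsets-unique n) n)))
  where
  rs : List (Vec (Subset n) n)
  rs = allVecs (allSubsets n) n

∈-allNC : (π : NC n) → π ∈ˡ allNC n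
∈-allNC {n} π
  with ρ , ρ∈ , eq ← ∈-map⁻ blockVec (subst (blockVec π ∈ˡ_) (sym (map-blockVec (allVecs (allSubsets n) n)))
    (∈-filter⁺ isNC? (∈-allVecs ∈-allSubsets (blockVec π))
      (isPartition (covers π) (coherent π) , nonCrossing π))) =
  subst (_∈ˡ allNC n) (NC-≡ λ i → cong (λ r → lookup r i) (sym eq)) ρ∈

-- Closed form of the functions u_q

module Convolution {c ℓ} (K : CommutativeRing c ℓ) where
  open CommutativeRing K hiding (zero)
    renaming (refl to ≈-refl; sym to ≈-sym; trans to ≈-trans; reflexive to ≈-reflexive)
  private module F = Functions K
  open F using (∑; ∏; _∗_; _≋_; fun; uValue)
  open Exp semiring using (_^_; ^-homo-*; ^-cong)
  open SetoidReasoning setoid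
  private
    module ∑ = ListFold +-commutativeMonoid
    module ∏ = ListFold *-commutativeMonoid

  ∑-*ˡ : (x : Carrier) (f : A → Carrier) (xs : List A) → ∑ (map (λ y → x * f y) xs) ≈ x * ∑ (map f xs)
  ∑-*ˡ x f []       = ≈-sym (zeroʳ x)
  ∑-*ˡ x f (y ∷ xs) = ≈-trans (+-congˡ (∑-*ˡ x f xs)) (≈-sym (distribˡ x _ _))

  ∏-^ : (x : Carrier) (f : A → ℕ) (xs : List A) → ∏ (map (λ y → x ^ f y) xs) ≈ x ^ ℕ-Fold.fold (map f xs)
  ∏-^ x f []       = ≈-refl
  ∏-^ x f (y ∷ xs) = ≈-trans (*-congˡ (∏-^ x f xs)) (≈-sym (^-homo-* x (f y) _))

  ∏-zero : (xs : List A) {f : ∀ {x} → x ∈ˡ xs → Carrier} {x : A} (x∈ : x ∈ˡ xs) →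
           f x∈ ≈ 0# → ∏ (mapWith∈ xs f) ≈ 0#
  ∏-zero (x ∷ xs) (here refl) e = ≈-trans (*-congʳ e) (zeroˡ _)
  ∏-zero (x ∷ xs) (there x∈)  e = ≈-trans (*-congˡ (∏-zero xs x∈ e)) (zeroʳ _)

  -- Defined for incomparable pairs too, so that sums can run over all of NC(n).
  U : Carrier → (π σ : NC n) → Carrier
  U q π σ = if does (π ≪? σ) then q ^ rank π σ else 0#

  module _ (q : Carrier) {π σ : NC n} where

    U-≪ : π ≪ σ → U q π σ ≈ q ^ rank π σ
    U-≪ h = ≈-reflexive (cong (if_then q ^ rank π σ else 0#) (dec-true (π ≪? σ) h))

    U-≪̸ : ¬ π ≪ σ → U q π σ ≈ 0#
    U-≪̸ h = ≈-reflexive (cong (if_then q ^ rank π σ else 0#) (dec-false (π ≪? σ) h))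

  U-cong : ∀ {q q′} (π σ : NC n) → q ≈ q′ → U q π σ ≈ U q′ π σ
  U-cong π σ e with does (π ≪? σ)
  ... | true  = ^-cong e (refl {x = rank π σ})
  ... | false = ≈-refl

  module _ (q : Carrier) .{{_ : NonZero n}} (π : NC n) where

    uValue-irreducible : Irreducible π → uValue q π ≈ q ^ (#blocks π ∸ 1)
    uValue-irreducible h = ≈-reflexive (cong (if_then q ^ (#blocks π ∸ 1) else 0#) (dec-true (irreducible? π) h))

    uValue-reducible : ¬ Irreducible π → uValue q π ≈ 0#
    uValue-reducible h = ≈-reflexive (cong (if_then q ^ (#blocks π ∸ 1) else 0#) (dec-false (irreducible? π) h))

  -- If π is irreducible on every block of σ, then π ≪ σ and the exponents add up to the rank by
  -- `sum-blocks`. Otherwise some factor is 0 and π ≪ σ fails.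
  u≈U : ∀ q {n} .{{_ : NonZero n}} (π σ : NC n) .(π≤σ : π ≤ σ) → fun (F.u q) (pair π σ π≤σ) ≈ U q π σ
  u≈U q {n} π σ π≤σ = by-cases (Fin.all? irr?)
    where
    finer-σ : ∀ {i j} → i ∼[ π ] j → i ∼[ σ ] j
    finer-σ (in-block j∈) = in-block (≤⇒⊆ π σ (recompute (π ≤? σ) π≤σ) _ j∈)

    -- Indexed by elements instead of blocks, so that `Fin.all?` applies.
    Irr : Pred (Fin n) _
    Irr i = Irreducible {{block-nonZero σ (blockOf∈blocks σ i)}} (π ↾ blockOf σ i)

    irr? : Decidable Irr
    irr? i = irreducible? {{block-nonZero σ (blockOf∈blocks σ i)}} (π ↾ blockOf σ i)

    new : Subset n → ℕ
    new W = count (λ i → (i ∈? W) ×-dec newMin? π σ i)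

    by-cases : Dec (∀ i → Irr i) → fun (F.u q) (pair π σ π≤σ) ≈ U q π σ
    by-cases (yes irr) = begin
      fun (F.u q) (pair π σ π≤σ)                  ≈⟨ ∏.fold-mapWith∈ (blocks σ) value ⟩
      ∏ (map (λ W → q ^ new W) (blocks σ))        ≈⟨ ∏-^ q new (blocks σ) ⟩
      q ^ ℕ-Fold.fold (map new (blocks σ))        ≡⟨ cong (q ^_) (sum-blocks σ (newMin? π σ)) ⟩
      q ^ rank π σ                                ≈⟨ U-≪ q π≪σ ⟨
      U q π σ                                     ∎
      where
      π≪σ : π ≪ σ
      π≪σ = mk≪ finer-σ λ {a} → Restriction.irreducible⇒ends finer-σ (blockOf∈blocks σ a) (irr a) (covers σ a)
      value : ∀ {W} (W∈ : W ∈ˡ blocks σ) → uValue q {{block-nonZero σ W∈}} (π ↾ W) ≈ q ^ new W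
      value {W} W∈ = ≈-trans
        (uValue-irreducible q {{block-nonZero σ W∈}} (π ↾ W) (Restriction.≪⇒irreducible finer-σ W∈ π≪σ))
        (≈-reflexive (cong (λ k → q ^ (k ∸ 1)) (Restriction.#blocks-↾ finer-σ W∈)))
    by-cases (no ¬irr) with i , ¬irrᵢ ← Fin.¬∀⟶∃¬ n Irr irr? ¬irr = ≈-trans
      (∏-zero (blocks σ) (blockOf∈blocks σ i)
        (uValue-reducible q {{block-nonZero σ (blockOf∈blocks σ i)}} (π ↾ blockOf σ i) ¬irrᵢ))
      (≈-sym (U-≪̸ q λ π≪σ → ¬irrᵢ (Restriction.≪⇒irreducible finer-σ (blockOf∈blocks σ i) π≪σ)))

  -- Recursion for the convolution sum

  module _ (q₁ q₂ : Carrier) where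

    term : (π σ ρ : NC n) → Carrier
    term π σ ρ = U q₁ π ρ * U q₂ ρ σ

    term-zero : {π σ ρ : NC n} → ¬ (π ≪ ρ × ρ ≪ σ) → term π σ ρ ≈ 0#
    term-zero {π = π} {σ} {ρ} h with π ≪? ρ
    ... | no _     = zeroˡ _
    ... | yes π≪ρ = ≈-trans (*-congˡ (U-≪̸ q₂ λ ρ≪σ → h (π≪ρ , ρ≪σ))) (zeroʳ _)

    term-≪ : {π σ ρ : NC n} → π ≪ ρ → ρ ≪ σ → term π σ ρ ≈ q₁ ^ rank π ρ * q₂ ^ rank ρ σ
    term-≪ π≪ρ ρ≪σ = *-cong (U-≪ q₁ π≪ρ) (U-≪ q₂ ρ≪σ)

    module Recursion {π σ : NC n} (π≪σ : π ≪ σ) (v : Fin n) (v-new : NewMin π σ v)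
      (v-least : ∀ u → u Fin.< v → IsMin π u → IsMin σ u) where

      open Cut π≪σ v (proj₁ v-new) (proj₂ v-new) v-least

      rank-upper : {ρ : NC n} → IsMin ρ v → rank ρ σ ≡ suc (rank ρ upper)
      rank-upper {ρ} v-minρ = count-suc (newMin? ρ σ) (newMin? ρ upper) v
        (v-minρ , proj₂ v-new) (λ (_ , ¬min) → ¬min upper-min-v)
        (λ i≢v (min , ¬min) → min , ¬min ∘ upper-min⁻ i≢v)
        (λ _ (min , ¬min) → min , ¬min ∘ upper-min⁺)

      rank-lower : {ρ : NC n} → ¬ IsMin ρ v → rank π ρ ≡ suc (rank lower ρ)
      rank-lower {ρ} v-¬minρ = count-suc (newMin? π ρ) (newMin? lower ρ) v
        (proj₁ v-new , v-¬minρ) (λ (min , _) → lower-¬min-v min)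
        (λ i≢v (min , ¬min) → lower-min⁺ i≢v min , ¬min)
        (λ _ (min , ¬min) → lower-min⁻ min , ¬min)

      π≪upper : π ≪ upper
      π≪upper = ≪upper (≪-refl π) π≪σ (proj₁ v-new)

      lower≪σ : lower ≪ σ
      lower≪σ = lower≪ π≪σ (≪-refl σ) (proj₂ v-new)

      -- For ρ between π and σ one summand on the right vanishes. If v is a minimum of ρ, then ρ ≪
      -- `upper`, whereas `lower` ≪ ρ would make v a minimum of `lower`. If not, then `lower` ≪ ρ,
      -- whereas ρ ≪ `upper` would make v a minimum of ρ. The other summand takes one factor q₂ or
      -- q₁ out of the term.
      term-split : (ρ : NC n) → term π σ ρ ≈ q₁ * term lower σ ρ + q₂ * term π upper ρ
      term-split ρ with (π ≪? ρ) ×-dec (ρ ≪? σ)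
      -- Both `lower` and `upper` lie between π and σ, so the right side vanishes too.
      ... | no ¬between = begin
        term π σ ρ                                    ≈⟨ term-zero ¬between ⟩
        0#                                            ≈⟨ +-identityˡ 0# ⟨
        0# + 0#                                       ≈⟨ +-cong (zeroʳ q₁) (zeroʳ q₂) ⟨
        q₁ * 0# + q₂ * 0#                             ≈⟨ +-cong
          (*-congˡ (term-zero λ (l≪ρ , ρ≪σ) → ¬between (≪-trans π≪lower l≪ρ , ρ≪σ)))
          (*-congˡ (term-zero λ (π≪ρ , ρ≪u) → ¬between (π≪ρ , ≪-trans ρ≪u upper≪σ))) ⟨
        q₁ * term lower σ ρ + q₂ * term π upper ρ     ∎
      ... | yes (π≪ρ , ρ≪σ) with isMin? ρ v
      ... | yes v-minρ = begin
        term π σ ρ                                    ≈⟨ term-≪ π≪ρ ρ≪σ ⟩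
        q₁ ^ rank π ρ * q₂ ^ rank ρ σ                 ≡⟨ cong (λ k → q₁ ^ rank π ρ * q₂ ^ k) (rank-upper v-minρ) ⟩
        q₁ ^ rank π ρ * (q₂ * q₂ ^ rank ρ upper)      ≈⟨ x∙yz≈y∙xz _ _ _ ⟩
        q₂ * (q₁ ^ rank π ρ * q₂ ^ rank ρ upper)      ≈⟨ *-congˡ (term-≪ π≪ρ (≪upper π≪ρ ρ≪σ v-minρ)) ⟨
        q₂ * term π upper ρ                           ≈⟨ +-identityˡ _ ⟨
        0# + q₂ * term π upper ρ                      ≈⟨ +-congʳ (zeroʳ q₁) ⟨
        q₁ * 0# + q₂ * term π upper ρ                 ≈⟨ +-congʳ (*-congˡ (term-zero
          λ (l≪ρ , _) → lower-¬min-v (min-antitone l≪ρ v-minρ))) ⟨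
        q₁ * term lower σ ρ + q₂ * term π upper ρ     ∎
        where open import Algebra.Properties.CommutativeSemigroup *-commutativeSemigroup using (x∙yz≈y∙xz)
      ... | no v-¬minρ = begin
        term π σ ρ                                    ≈⟨ term-≪ π≪ρ ρ≪σ ⟩
        q₁ ^ rank π ρ * q₂ ^ rank ρ σ                 ≡⟨ cong (λ k → q₁ ^ k * q₂ ^ rank ρ σ) (rank-lower v-¬minρ) ⟩
        (q₁ * q₁ ^ rank lower ρ) * q₂ ^ rank ρ σ      ≈⟨ *-assoc _ _ _ ⟩
        q₁ * (q₁ ^ rank lower ρ * q₂ ^ rank ρ σ)      ≈⟨ *-congˡ (term-≪ (lower≪ π≪ρ ρ≪σ v-¬minρ) ρ≪σ) ⟨
        q₁ * term lower σ ρ                           ≈⟨ +-identityʳ _ ⟨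
        q₁ * term lower σ ρ + 0#                      ≈⟨ +-congˡ (zeroʳ q₂) ⟨
        q₁ * term lower σ ρ + q₂ * 0#                 ≈⟨ +-congˡ (*-congˡ (term-zero
          λ (_ , ρ≪u) → v-¬minρ (min-antitone ρ≪u upper-min-v))) ⟨
        q₁ * term lower σ ρ + q₂ * term π upper ρ     ∎

    -- Induction on the rank, which is passed as `k` to make the recursion structural.
    ∑-terms : ∀ k (π σ : NC n) → rank π σ ≡ k → ∑ (map (term π σ) (allNC n)) ≈ U (q₁ + q₂) π σ
    ∑-terms {n} k π σ rank≡k with π ≪? σ
    ... | no π≪̸σ  = ∑.fold-ε (allNC n) λ _ → term-zero λ (π≪ρ , ρ≪σ) → π≪̸σ (≪-trans π≪ρ ρ≪σ)
    ... | yes π≪σ with Fin.any? (newMin? π σ)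
    -- Without new minima π and σ coincide, and antisymmetry leaves the one term with ρ = π.
    ... | no none with refl ← ≪-sameMin π≪σ (λ i min → decidable-stable (isMin? σ i) λ ¬min → none (i , min , ¬min)) = begin
      ∑ (map (term π π) (allNC n))        ≈⟨ ∑.fold-single (allNC-unique n) (∈-allNC π)
        (λ _ ρ≢π → term-zero λ (π≪ρ , ρ≪π) → ρ≢π (≪-antisym ρ≪π π≪ρ)) ⟩
      term π π π                          ≈⟨ term-≪ (≪-refl π) (≪-refl π) ⟩
      q₁ ^ rank π π * q₂ ^ rank π π       ≡⟨ cong (λ k → q₁ ^ k * q₂ ^ k) rank≡0 ⟩
      1# * 1#                             ≈⟨ *-identityˡ 1# ⟩
      1#                                  ≡⟨ cong ((q₁ + q₂) ^_) rank≡0 ⟨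
      (q₁ + q₂) ^ rank π π                ∎
      where
      rank≡0 : rank π π ≡ 0
      rank≡0 = count-none (newMin? π π) λ i (min , ¬min) → ¬min min
    ... | yes some with v , v-new , least-v ← least (newMin? π σ) some = by-rank k rank≡k
      where
      v-least : ∀ u → u Fin.< v → IsMin π u → IsMin σ u
      v-least u u<v min = decidable-stable (isMin? σ u) λ ¬min → ℕ.<⇒≱ u<v (least-v u (min , ¬min))
      open Cut π≪σ v (proj₁ v-new) (proj₂ v-new) v-least using (lower; upper)
      open Recursion π≪σ v v-new v-least
      by-rank : ∀ k → rank π σ ≡ k → ∑ (map (term π σ) (allNC n)) ≈ (q₁ + q₂) ^ rank π σ
      -- Rank 0 is impossible as v is counted: `rank-upper` at ρ = π gives a successor.
      by-rank zero    eq with () ← trans (sym eq) (rank-upper (proj₁ v-new))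
      by-rank (suc k) eq = begin
        ∑ (map (term π σ) (allNC n))
          ≈⟨ ∑.fold-cong (allNC n) (λ {ρ} _ → term-split ρ) ⟩
        ∑ (map (λ ρ → q₁ * term lower σ ρ + q₂ * term π upper ρ) (allNC n))
          ≈⟨ ∑.fold-∙ _ _ (allNC n) ⟩
        ∑ (map (λ ρ → q₁ * term lower σ ρ) (allNC n)) + ∑ (map (λ ρ → q₂ * term π upper ρ) (allNC n))
          ≈⟨ +-cong (∑-*ˡ q₁ _ (allNC n)) (∑-*ˡ q₂ _ (allNC n)) ⟩
        q₁ * ∑ (map (term lower σ) (allNC n)) + q₂ * ∑ (map (term π upper) (allNC n))
          ≈⟨ +-cong (*-congˡ (∑-terms k lower σ lower-k)) (*-congˡ (∑-terms k π upper upper-k)) ⟩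
        q₁ * U (q₁ + q₂) lower σ + q₂ * U (q₁ + q₂) π upper
          ≈⟨ +-cong (*-congˡ (U-≪ _ lower≪σ)) (*-congˡ (U-≪ _ π≪upper)) ⟩
        q₁ * (q₁ + q₂) ^ rank lower σ + q₂ * (q₁ + q₂) ^ rank π upper
          ≡⟨ cong₂ (λ k l → q₁ * (q₁ + q₂) ^ k + q₂ * (q₁ + q₂) ^ l) lower-k upper-k ⟩
        q₁ * (q₁ + q₂) ^ k + q₂ * (q₁ + q₂) ^ k
          ≈⟨ distribʳ _ _ _ ⟨
        (q₁ + q₂) ^ suc k
          ≡⟨ cong ((q₁ + q₂) ^_) eq ⟨
        (q₁ + q₂) ^ rank π σ ∎
        where
        lower-k : rank lower σ ≡ k
        lower-k = ℕ.suc-injective (trans (sym (rank-lower (proj₂ v-new))) eq)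
        upper-k : rank π upper ≡ k
        upper-k = ℕ.suc-injective (trans (sym (rank-upper (proj₁ v-new))) eq)

    -- With variables f, g and h, no elements of G̃ over ℂ have to be compared by unfolding.
    u-∗ : ∀ {q} → q₁ + q₂ ≈ q → {f g h : NC⁽²⁾ → Carrier} →
          f ≡ fun (F.u q₁) → g ≡ fun (F.u q₂) → h ≡ fun (F.u q) → f ∗ g ≋ h
    u-∗ {q} q₁+q₂≈q refl refl refl (pair {n} π σ π≤σ) = begin
      (fun (F.u q₁) ∗ fun (F.u q₂)) (pair π σ π≤σ)
        ≈⟨ ∑.fold-mapWith∈ (interval π σ) (λ {ρ} ρ∈ → *-cong
             (u≈U q₁ π ρ (proj₁ (∈interval⁻ π σ ρ∈))) (u≈U q₂ ρ σ (proj₂ (∈interval⁻ π σ ρ∈)))) ⟩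
      ∑ (map (term π σ) (interval π σ))
        -- Terms outside the interval are 0, because ≪ implies ≤.
        ≈⟨ ∑.fold-filter (λ ρ → (π ≤? ρ) ×-dec (ρ ≤? σ)) (allNC n)
             (λ ¬between → term-zero λ (π≪ρ , ρ≪σ) → ¬between (≪⇒≤ π≪ρ , ≪⇒≤ ρ≪σ)) ⟩
      ∑ (map (term π σ) (allNC n))
        ≈⟨ ∑-terms _ π σ refl ⟩
      U (q₁ + q₂) π σ
        ≈⟨ U-cong π σ q₁+q₂≈q ⟩
      U q π σ
        ≈⟨ u≈U q π σ π≤σ ⟨
      fun (F.u q) (pair π σ π≤σ) ∎

-- Real parameters and complex values

open Defs using (_∗_; _≋_; fun; u)

proposition9p3 : (q₁ q₂ : ℝ) → fun (u q₁) ∗ fun (u q₂) ≋ fun (u (q₁ +ᵣ q₂))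
proposition9p3 q₁ q₂ = u-∗ (q₁ +i fromℚ 0ℚ) (q₂ +i fromℚ 0ℚ) {(q₁ +ᵣ q₂) +i fromℚ 0ℚ}
  -- The imaginary part of the sum is 0 + 0, equal to 0 only up to ≃; hence `u-∗` takes q together
  -- with an equation.
  (≃-refl {q₁ +ᵣ q₂} , +-identityˡ (fromℚ 0ℚ))
  {fun (u q₁)} {fun (u q₂)} {fun (u (q₁ +ᵣ q₂))} refl refl refl
  where
  open Convolution ℂ-commutativeRing using (u-∗)
  open CommutativeRing ℝ-commutativeRing using (+-identityˡ) renaming (refl to ≃-refl)
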